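{- There is an $n_0$ such that every fair complete $k$-partite graph $G$ ($k\ge 2$) on at least $n_0$ vertices whose edges are coloured red and blue can be partitioned into $14$ monochromatic cycles (i.e. its vertex set is the disjoint union of the vertex sets of at most $14$ cycles, each of which has all edges of one colour). If $k=2$, then $G$ can be partitioned into $12$ monochromatic cycles.
   Context: A complete $k$-partite graph has $k$ non-empty partition classes, with two vertices adjacent iff they lie in distinct classes. A multipartite graph on $n$ vertices is fair if no partition class contains more than $n/2$ vertices. A colouring is any assignment of red/blue to the edges. A cycle is allowed to consist of a single vertex or a single edge, or to be empty. -}

module Defs where

open import Data.Nat using (ℕ; _*_; _≤_)
open import Data.Fin using (Fin) renaming (_≟_ to _≟ᶠ_)
open import Data.Bool using (Bool)
open import Data.List using (List; []; _∷_; length; filter; allFin; concat; map)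
open import Data.List.Relation.Unary.All using (All)
open import Data.List.Relation.Binary.Permutation.Propositional using (_↭_)
open import Data.Product using (Σ; _×_; ∃; proj₂)
open import Data.Unit using (⊤)
open import Relation.Binary.PropositionalEquality using (_≡_; _≢_)

-- A complete k-partite graph on vertex set Fin n is given by the class map
-- p : Fin n → Fin k (u,v adjacent iff p u ≢ p v).

ClassesNonEmpty : ∀ {n k} → (Fin n → Fin k) → Set
ClassesNonEmpty {n} {k} p = (i : Fin k) → ∃ λ v → p v ≡ i

classSize : ∀ {n k} → (Fin n → Fin k) → Fin k → ℕ
classSize {n} p i = length (filter (λ v → p v ≟ᶠ i) (allFin n))

Fair : ∀ {n k} → (Fin n → Fin k) → Set
Fair {n} {k} p = (i : Fin k) → 2 * classSize p i ≤ n

-- A red/blue edge colouring: symmetric function on pairs (values on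
-- non-edges are irrelevant).
Colouring : ℕ → Set
Colouring n = Fin n → Fin n → Bool

Symmetric : ∀ {n} → Colouring n → Set
Symmetric {n} c = (u v : Fin n) → c u v ≡ c v u

EdgeOf : ∀ {n k} → (Fin n → Fin k) → Colouring n → Bool → Fin n → Fin n → Set
EdgeOf p c b u v = (p u ≢ p v) × (c u v ≡ b)

ClosedWalkFrom : ∀ {n k} → (Fin n → Fin k) → Colouring n → Bool →
                 Fin n → Fin n → List (Fin n) → Set
ClosedWalkFrom p c b first x []       = EdgeOf p c b x first
ClosedWalkFrom p c b first x (y ∷ ys) = EdgeOf p c b x y × ClosedWalkFrom p c b first y ys

-- A monochromatic (colour b) cycle given by its cyclic vertex sequence
-- (vertex distinctness is ensured by the partition condition).
-- The empty list, a single vertex, and a single edge (u ∷ v ∷ []) are cycles.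
MonoCycle : ∀ {n k} → (Fin n → Fin k) → Colouring n → Bool → List (Fin n) → Set
MonoCycle p c b []           = ⊤
MonoCycle p c b (x ∷ [])     = ⊤
MonoCycle p c b (x ∷ y ∷ ys) = ClosedWalkFrom p c b x x (y ∷ ys)

PartitionIntoMonoCycles : ∀ {n k} → (Fin n → Fin k) → Colouring n → ℕ → Set
PartitionIntoMonoCycles {n} p c m =
  Σ (List (Σ Bool λ _ → List (Fin n))) λ cs →
    (length cs ≤ m)
    × All (λ bc → MonoCycle p c (Data.Product.proj₁ bc) (proj₂ bc)) cs
    × (concat (map proj₂ cs) ↭ allFin n)

{-# OPTIONS --safe #-}
module Submission where

-- Drop a vertex if n is odd. The classes can be grouped into three parts A, B, C of at most n/2 vertices each, and these
-- can be paired off into balanced complete bipartite regions inside A ∪ B, B ∪ C and A ∪ C, one of which is large. In the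
-- large one, say inside A ∪ C, Ramsey's theorem gives a complete bipartite K = (K₁ ⊆ A, K₂ ⊆ C) of bounded size in one
-- colour b. Each remaining vertex lies on the side of K₁ or of K₂; it is near if it has many b-neighbours in the opposite
-- side of K, and far if almost all its edges to that side have the other colour. Few b-coloured paths with near ends can
-- be threaded into one b-cycle through all the rest of K, and few other-coloured paths with far ends on the same side can
-- be linked into one cycle through K, so boundedly many such paths ("pieces") cost three cycles altogether.
--
-- Depth-first search along a colour splits a balanced complete bipartite graph into a path of that colour and two balanced
-- complete bipartite graphs of the other colour. If the near vertices of a region on one side are matched with far vertices
-- on the other side, all three parts become pieces. Only vertices of one type are left over; searching them along the
-- colour of their own type yields pieces and two cycles. In total this is 1 + 3 + 3 · 2 = 10 cycles, for every k.

open import Defs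
open import Data.Nat using (ℕ; zero; suc; _+_; _*_; _∸_; _^_; _≤_; _<_; z≤n; s≤s)
open import Data.Nat.Properties
open import Data.Nat.Solver using (module +-*-Solver)
open import Data.Fin using (Fin; toℕ; fromℕ<) renaming (_≟_ to _≟ᶠ_)
open import Data.Fin.Properties using (toℕ<n; toℕ-injective; toℕ-fromℕ<)
open import Data.Bool using (Bool; true; false; not)
open import Data.Bool.Properties using (¬-not) renaming (_≟_ to _≟ᵇ_)
open import Data.List using (List; []; _∷_; _++_; length; filter; allFin; concat; map; concatMap)
open import Data.List.Properties using (++-assoc; ++-identityʳ; length-++; filter-none; filter-++; length-filter; concatMap-++; map-++; concat-++; filter-all; length-tabulate)
open import Data.List.Membership.Propositional using (_∈_; find)
open import Data.List.Membership.Propositional.Properties using (∈-∃++; ∈-++⁺ʳ; ∈-++⁺ˡ; ∈-filter⁻)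
open import Data.List.Relation.Unary.All as All using (All; []; _∷_)
open import Data.List.Relation.Unary.All.Properties using (++⁺; ++⁻ˡ; ++⁻ʳ; ¬Any⇒All¬)
open import Data.List.Relation.Unary.Any using (any?; here; there)
open import Data.List.Relation.Binary.Permutation.Propositional using (_↭_; prep; module PermutationReasoning; ↭-refl; ↭-sym; ↭-trans; ↭-reflexive)
import Data.List.Relation.Binary.Permutation.Propositional.Properties as ↭
open import Data.Product using (Σ; ∃; ∃₂; _×_; _,_; proj₁; proj₂)
open import Data.Sum using (_⊎_; inj₁; inj₂; swap) renaming (map to map⊎)
open import Data.Empty using (⊥-elim)
open import Data.Unit using (⊤; tt)
open import Function using (_∘_; id)
open import Relation.Binary.Definitions using (tri<; tri≈; tri>)
open import Relation.Nullary using (¬_; Dec; yes; no; contradiction)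
open import Relation.Nullary.Decidable using (¬?; _⊎-dec_; decidable-stable)
open import Relation.Unary using (Decidable)
open import Relation.Binary.PropositionalEquality using (_≡_; _≢_; refl; sym; trans; cong; cong₂; subst)

-- Lists, permutations and arithmetic

module _ {V : Set} where

  open import Algebra.Solver.CommutativeMonoid (↭.++-commutativeMonoid {A = V}) public
    using (solve; _⊜_; _⊕_) renaming (id to id′)

  extract : ∀ {x : V} {K} → x ∈ K → ∃ λ K′ → K ↭ x ∷ K′
  extract {x} x∈K with ys , zs , refl ← ∈-∃++ x∈K = ys ++ zs , ↭.shift x ys zs

  length-cover : {P Q : V → Set} (P? : Decidable P) (Q? : Decidable Q) {K : List V} →
    All (λ k → P k ⊎ Q k) K → length K ≤ length (filter P? K) + length (filter Q? K)
  length-cover P? Q? [] = z≤n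
  length-cover P? Q? (_∷_ {k} {K} pq pqs) with P? k | Q? k | length-cover P? Q? pqs
  ... | yes _ | yes _ | ih = s≤s (≤-trans ih (+-monoʳ-≤ _ (n≤1+n _)))
  ... | yes _ | no _  | ih = s≤s ih
  ... | no _  | yes _ | ih = ≤-trans (s≤s ih) (≤-reflexive (sym (+-suc _ _)))
  ... | no ¬p | no ¬q | ih with pq
  ...   | inj₁ p = contradiction p ¬p
  ...   | inj₂ q = contradiction q ¬q

  All-transpose : {W : Set} {R : V → W → Set} {X : List V} {Y : List W} →
    All (λ x → All (R x) Y) X → All (λ y → All (λ x → R x y) X) Y
  All-transpose [] = All.tabulate (λ _ → [])
  All-transpose (rx ∷ rxs) = All.zipWith (λ (a , b) → a ∷ b) (rx , All-transpose rxs)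

-- The two sides of the equation count the vertices of K₁ and of K₂ that are used up when a, a′ near and f, f′ far pieces
-- from the two sides are linked, apart from one initial vertex on each side.
connector-count : ∀ a f a′ f′ {θ} → a + f ≡ a′ + f′ → 3 * (a + f) < θ →
  f′ + a + a′ * 2 ≡ f + a * 2 + a′ × f′ + a + a′ * 2 < θ × f + a * 2 + a′ < θ
connector-count a f a′ f′ {θ} eq bound = balance , subst (_< θ) (sym balance) below , below
  where
  open +-*-Solver using (_:+_; _:*_; _:=_; con) renaming (solve to ring)
  e₁ : f′ + a + a′ * 2 ≡ (a′ + f′) + (a + a′)
  e₁ = ring 3 (λ f a a′ → f :+ a :+ a′ :* con 2 := (a′ :+ f) :+ (a :+ a′)) refl f′ a a′
  e₂ : f + a * 2 + a′ ≡ (a + f) + (a + a′)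
  e₂ = ring 3 (λ f a a′ → f :+ a :* con 2 :+ a′ := (a :+ f) :+ (a :+ a′)) refl f a a′
  balance : f′ + a + a′ * 2 ≡ f + a * 2 + a′
  balance = trans e₁ (trans (cong (_+ (a + a′)) (sym eq)) (sym e₂))
  below : f + a * 2 + a′ < θ
  below = begin-strict
    f + a * 2 + a′                  ≡⟨ e₂ ⟩
    (a + f) + (a + a′)              ≤⟨ +-monoʳ-≤ (a + f) (+-mono-≤ (m≤m+n a f) (≤-trans (m≤m+n a′ f′) (≤-reflexive (sym eq)))) ⟩
    (a + f) + ((a + f) + (a + f))   ≡⟨ cong (λ z → (a + f) + ((a + f) + z)) (sym (+-identityʳ (a + f))) ⟩
    3 * (a + f)                     <⟨ bound ⟩
    θ                               ∎
    where open ≤-Reasoning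

split-at : {V : Set} (m : ℕ) {X : List V} → m ≤ length X → ∃₂ λ X₁ X₂ → X ≡ X₁ ++ X₂ × length X₁ ≡ m
split-at zero _ = [] , _ , refl , refl
split-at (suc m) {x ∷ X} (s≤s le) with X₁ , X₂ , eq , len ← split-at m {X} le = x ∷ X₁ , X₂ , cong (x ∷_) eq , cong suc len

disjoint-filters : {A : Set} {P Q : A → Set} (P? : Decidable P) (Q? : Decidable Q) → (∀ {x} → P x → ¬ Q x) →
  (L : List A) → length (filter P? L) + length (filter Q? L) ≤ length L
disjoint-filters P? Q? dis [] = z≤n
disjoint-filters P? Q? dis (x ∷ L) with P? x | Q? x | disjoint-filters P? Q? dis L
... | yes px | yes qx | _  = contradiction qx (dis px)
... | yes _  | no _   | ih = s≤s ih
... | no _   | yes _  | ih = ≤-trans (≤-reflexive (+-suc _ _)) (s≤s ih)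
... | no _   | no _   | ih = m≤n⇒m≤1+n ih

length-drop-prefix : {A : Set} (m : ℕ) (X₁ : List A) {X₂ : List A} {u v : ℕ} → length X₁ ≡ m →
  length (X₁ ++ X₂) + u ≡ v + m → length X₂ + u ≡ v
length-drop-prefix m X₁ {X₂} {u} {v} refl eq = +-cancelˡ-≡ (length X₁) _ _
  (trans (sym (+-assoc (length X₁) (length X₂) u)) (trans (cong (_+ u) (sym (length-++ X₁))) (trans eq (+-comm v _))))

last-below : {P : ℕ → Set} (P? : Decidable P) → P 0 → ∀ N → ¬ P N → ∃ λ m → m < N × P m × ¬ P (suc m)
last-below P? p₀ zero ¬p = contradiction p₀ ¬p
last-below P? p₀ (suc N) ¬p with P? N
... | yes p = N , ≤-refl , p , ¬p
... | no ¬q with m , m<N , pm , ¬ps ← last-below P? p₀ N ¬q = m , m<n⇒m<1+n m<N , pm , ¬ps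

half-≤ : ∀ {m n} → m + m ≤ n + n → m ≤ n
half-≤ {m} {n} le with m ≤? n
... | yes p = p
... | no ¬p = contradiction le (<⇒≱ (+-mono-< (≰⇒> ¬p) (≰⇒> ¬p)))

parity : ∀ m → (∃ λ h → m ≡ h + h) ⊎ (∃ λ h → m ≡ suc (h + h))
parity zero = inj₁ (0 , refl)
parity (suc m) with parity m
... | inj₁ (h , eq) = inj₂ (h , cong suc eq)
... | inj₂ (h , eq) = inj₁ (suc h , cong suc (trans eq (sym (+-suc h h))))

half-odd : ∀ {m h l} → m ≡ suc (h + h) → 2 * l ≤ m → l ≤ h
half-odd {h = h} {l} refl le with l ≤? h
... | yes p = p
... | no ¬p = contradiction (≤-trans (≤-reflexive (cong (l +_) (sym (+-identityʳ l)))) le)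
  (<⇒≱ (≤-trans (s≤s (≤-reflexive (sym (+-suc h h)))) (+-mono-≤ (≰⇒> ¬p) (≰⇒> ¬p))))

2^-suc-* : ∀ m t → 2 ^ suc m * t ≡ 2 ^ m * t + 2 ^ m * t
2^-suc-* m t = trans (*-assoc 2 (2 ^ m) t) (cong (2 ^ m * t +_) (+-identityʳ (2 ^ m * t)))

larger-half : ∀ {m a b} → m + m ≤ a + b → m ≤ a ⊎ m ≤ b
larger-half {m} {a} {b} le with m ≤? a | m ≤? b
... | yes p | _ = inj₁ p
... | no _  | yes p = inj₂ p
... | no p  | no q = contradiction le (<⇒≱ (+-mono-< (≰⇒> p) (≰⇒> q)))

-- The number of pairs in a complete bipartite graph that forces a monochromatic K_{t,t}.
region-bound : ℕ → ℕ
region-bound t = (t + t) + 2 ^ (t + t) * t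

-- Each side of K gets `θ + (θ + θ)` vertices, which `N` pairs force. The regions hold h pairs on 2h
-- vertices, and `N + (N + N) ≤ h` makes one of them large; `suc` supplies the positive order that
-- `median-class` asks for.
order-bound : ℕ → ℕ
order-bound θ = let N = region-bound (θ + (θ + θ)) in suc (2 * (N + (N + N)))

trisect : {A : Set} {P Q R : A → Set} (P? : Decidable P) (Q? : Decidable Q) (R? : Decidable R) →
  (∀ {x} → P x → ¬ Q x) → (∀ {x} → P x → ¬ R x) → (∀ {x} → Q x → ¬ R x) → (∀ x → P x ⊎ Q x ⊎ R x) →
  (L : List A) → L ↭ filter P? L ++ filter Q? L ++ filter R? L
trisect P? Q? R? pq pr qr total [] = ↭-refl
trisect P? Q? R? pq pr qr total (x ∷ L) with P? x | Q? x | R? x | trisect P? Q? R? pq pr qr total L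
... | yes p | yes q | _     | _  = contradiction q (pq p)
... | yes p | no _  | yes r | _  = contradiction r (pr p)
... | yes _ | no _  | no _  | ih = prep x ih
... | no _  | yes q | yes r | _  = contradiction r (qr q)
... | no _  | yes _ | no _  | ih = ↭-trans (prep x ih) (↭-sym (↭.shift x (filter P? L) _))
... | no _  | no _  | yes _ | ih = ↭-trans (prep x ih)
  (solve 4 (λ x a b c → x ⊕ (a ⊕ (b ⊕ c)) ⊜ a ⊕ (b ⊕ (x ⊕ c))) ↭-refl (x ∷ []) (filter P? L) (filter Q? L) (filter R? L))
... | no ¬p | no ¬q | no ¬r | _ with total x
...   | inj₁ p = contradiction p ¬p
...   | inj₂ (inj₁ q) = contradiction q ¬q
...   | inj₂ (inj₂ r) = contradiction r ¬r

length-allFin : ∀ n → length (allFin n) ≡ n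
length-allFin n = length-tabulate id

-- Walks and cycles in a coloured multipartite graph

module Coloured {n k : ℕ} (p : Fin n → Fin k) (c : Colouring n) (c-sym : Symmetric c) where

  V : Set
  V = Fin n

  Adj : V → V → Set
  Adj u v = p u ≢ p v

  E : Bool → V → V → Set
  E = EdgeOf p c

  E-sym : ∀ {b u v} → E b u v → E b v u
  E-sym (u≁v , e) = u≁v ∘ sym , trans (c-sym _ _) e

  E-cases : ∀ b {u v} → Adj u v → E b u v ⊎ E (not b) u v
  E-cases b {u} {v} u≁v with c u v ≟ᵇ b
  ... | yes e = inj₁ (u≁v , e)
  ... | no ¬e = inj₂ (u≁v , ¬-not ¬e)

  Mono : Bool → List V → List V → Set
  Mono b X Y = All (λ x → All (E b x) Y) X

  Mono-sym : ∀ {b X Y} → Mono b X Y → Mono b Y X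
  Mono-sym = All.map (All.map E-sym) ∘ All-transpose

  data Walk (b : Bool) : V → V → List V → Set where
    stop : ∀ x → Walk b x x (x ∷ [])
    _∷_ : ∀ {x y z l} → E b x y → Walk b y z l → Walk b x z (x ∷ l)

  infixr 5 _∷_

  join : ∀ {b x y y′ z l l′} → Walk b x y l → E b y y′ → Walk b y′ z l′ → Walk b x z (l ++ l′)
  join (stop _) e w′ = e ∷ w′
  join (e₀ ∷ w) e w′ = e₀ ∷ join w e w′

  close-from : ∀ {b f x y z l} → E b x y → Walk b y z l → E b z f → ClosedWalkFrom p c b f x l
  close-from e (stop _) e′ = e , e′
  close-from e (e₁ ∷ w) e′ = e , close-from e₁ w e′

  close : ∀ {b x z l} → Walk b x z l → E b z x → MonoCycle p c b l
  close (stop _) _ = tt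
  -- Matching on `w` exposes its vertex list, so that `MonoCycle` reduces.
  close (e ∷ w@(stop _)) e′ = close-from e w e′
  close (e ∷ w@(_ ∷ _)) e′ = close-from e w e′

  -- Alternating walks whose last vertex is a Q₁-vertex; Odd starts at a Q₁-vertex, Even is empty or starts at a Q₂-vertex.
  data Odd (b : Bool) (Q₁ Q₂ : V → Set) : V → List V → Set where
    start : ∀ {x} → Q₁ x → Odd b Q₁ Q₂ x (x ∷ [])
    step  : ∀ {x y x′ l} → Q₁ x → Q₂ y → E b x y → E b y x′ → Odd b Q₁ Q₂ x′ l →
            Odd b Q₁ Q₂ x (x ∷ y ∷ l)

  data Even (b : Bool) (Q₁ Q₂ : V → Set) : List V → Set where
    none : Even b Q₁ Q₂ []
    cons : ∀ {y x l} → Q₂ y → E b y x → Odd b Q₁ Q₂ x l → Even b Q₁ Q₂ (y ∷ l)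

  odd-walk : ∀ {b Q₁ Q₂ x l} → Odd b Q₁ Q₂ x l → Q₁ x × ∃ λ z → Q₁ z × Walk b x z l
  odd-walk (start q) = q , _ , q , stop _
  odd-walk (step q _ e e′ o) with _ , z , q′ , w ← odd-walk o = q , z , q′ , e ∷ e′ ∷ w

  -- Monochromatic balanced complete bipartite graphs

  record Blob (b : Bool) (Q₁ Q₂ : V → Set) (L : List V) : Set where
    constructor blob
    field
      {X Y} : List V
      split : L ↭ X ++ Y
      allX  : All Q₁ X
      allY  : All Q₂ Y
      size  : length X ≡ length Y
      mono  : Mono b X Y

  blob-sym : ∀ {b Q₁ Q₂ L} → Blob b Q₁ Q₂ L → Blob b Q₂ Q₁ L
  blob-sym (blob {X} {Y} s qx qy e m) = blob (↭-trans s (↭.++-comm X Y)) qy qx (sym e) (Mono-sym m)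

  -- There is one vertex more in `x ∷ X` than in `Y`, so the walk also ends there. The end is known
  -- only existentially; hence the last component offers the closing edge for every `y` adjacent to
  -- all of `x ∷ X`.
  zigzag : ∀ {b Q₁ Q₂ x X Y} → All Q₁ (x ∷ X) → All Q₂ Y → length X ≡ length Y → Mono b (x ∷ X) Y →
    ∃ λ l → x ∷ X ++ Y ↭ l × Odd b Q₁ Q₂ x l × (∀ {y} → All (λ x′ → E b x′ y) (x ∷ X) → ∃ λ z → Walk b x z l × E b z y)
  zigzag {X = []} {[]} (q ∷ _) _ _ _ = _ , ↭-refl , start q , λ { (e ∷ _) → _ , stop _ , e }
  zigzag {x = x} {X = x′ ∷ X} {y ∷ Y} (q ∷ qs) (r ∷ rs) eq ((e ∷ _) ∷ m@((e′ ∷ _) ∷ _))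
    with l , l↭ , o , end ← zigzag qs rs (suc-injective eq) (All.map All.tail m) =
    x ∷ y ∷ l ,
    prep x (↭-trans (↭.shift y (x′ ∷ X) Y) (prep y l↭)) ,
    step q r e (E-sym e′) o ,
    λ { (_ ∷ es) → let z , w , ez = end es in z , e ∷ E-sym e′ ∷ w , ez }

  -- One vertex `y` is set aside; the rest is a zigzag with both ends on the other side, which `y`
  -- closes. The list is also returned as an alternating walk, for cutting it open instead.
  blob-cycle : ∀ {b Q₁ Q₂ L} → Blob b Q₁ Q₂ L → ∃ λ l → L ↭ l × Even b Q₁ Q₂ l × MonoCycle p c b l
  blob-cycle (blob {[]} {[]} s _ _ _ _) = [] , s , none , tt
  blob-cycle {b} (blob {x ∷ X} {y ∷ Y} s qs (r ∷ rs) eq m@((e ∷ _) ∷ _))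
    with l , l↭ , o , end ← zigzag qs rs (suc-injective eq) (All.map All.tail m)
    with z , w , ez ← end (All.map All.head m) =
    y ∷ l , ↭-trans s (↭-trans (↭.shift y (x ∷ X) Y) (prep y l↭)) , cons r (E-sym e) o , close (E-sym e ∷ w) ez

  -- Depth-first search in a bipartite graph

  module Search {b b′ : Bool} {Q₁ Q₂ : V → Set} (cases : ∀ {x y} → Q₁ x → Q₂ y → E b x y ⊎ E b′ x y) where

    -- The second alternative is what lets the search finish `y`: towards the unvisited vertices it
    -- has only edges of colour `b′`.
    find₁ : ∀ {y U} → Q₂ y → All Q₁ U → (∃₂ λ x U′ → U ↭ x ∷ U′ × E b x y) ⊎ All (E b′ y) U
    find₁ r [] = inj₂ []
    find₁ {U = x ∷ U} r (q ∷ qs) with cases q r | find₁ r qs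
    ... | inj₁ e | _ = inj₁ (x , U , ↭-refl , e)
    ... | inj₂ e | inj₁ (x′ , U′ , s , e′) = inj₁ (x′ , x ∷ U′ , ↭-trans (prep x s) (↭.shifts (x ∷ []) (x′ ∷ [])) , e′)
    ... | inj₂ e | inj₂ es = inj₂ (E-sym e ∷ es)

    find₂ : ∀ {x U} → Q₁ x → All Q₂ U → (∃₂ λ y U′ → U ↭ y ∷ U′ × E b x y) ⊎ All (E b′ x) U
    find₂ q [] = inj₂ []
    find₂ {U = y ∷ U} q (r ∷ rs) with cases q r | find₂ q rs
    ... | inj₁ e | _ = inj₁ (y , U , ↭-refl , e)
    ... | inj₂ e | inj₁ (y′ , U′ , s , e′) = inj₁ (y′ , y ∷ U′ , ↭-trans (prep y s) (↭.shifts (y ∷ []) (y′ ∷ [])) , e′)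
    ... | inj₂ e | inj₂ es = inj₂ (e ∷ es)

    Outcome : List V → Set
    Outcome L = ∃ λ l → ∃₂ λ M N → Even b Q₁ Q₂ l × Blob b′ Q₁ Q₂ M × Blob b′ Q₁ Q₂ N × L ↭ l ++ M ++ N

    outcome-↭ : ∀ {L L′} → L ↭ L′ → Outcome L′ → Outcome L
    outcome-↭ s (l , M , N , o , B , B′ , t) = l , M , N , o , B , B′ , ↭-trans s t

    -- Depth-first search along colour b: U₁, U₂ are the unvisited vertices on the two sides, S₁, S₂ the finished ones.
    -- Every step lowers |U₁| + |U₂| − |S₁| − |S₂| by one, and when it reaches zero both pairs (U₁, S₂) and (S₁, U₂) are balanced.
    mutual
      search-even : ∀ e {U₁ U₂ S₁ S₂ l} → All Q₁ U₁ → All Q₂ U₂ → All Q₁ S₁ → All Q₂ S₂ → Even b Q₁ Q₂ l →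
        Mono b′ S₂ U₁ → Mono b′ S₁ U₂ → length U₁ ≡ e + length S₂ → length U₂ ≡ e + length S₁ →
        Outcome (U₁ ++ U₂ ++ S₁ ++ S₂ ++ l)
      search-even zero {U₁} {U₂} {S₁} {S₂} {l} u₁ u₂ s₁ s₂ o m₁ m₂ eq₁ eq₂ =
        l , U₁ ++ S₂ , S₁ ++ U₂ , o ,
        blob ↭-refl u₁ s₂ eq₁ (Mono-sym m₁) , blob ↭-refl s₁ u₂ (sym eq₂) m₂ ,
        solve 5 (λ a b c d e → (a ⊕ (b ⊕ (c ⊕ (d ⊕ e)))) ⊜ (e ⊕ ((a ⊕ d) ⊕ (c ⊕ b)))) ↭-refl U₁ U₂ S₁ S₂ l
      -- The walk is empty while unvisited vertices remain, so it restarts at one of them.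
      search-even (suc e) {x ∷ U₁} {U₂} {S₁} {S₂} (q ∷ u₁) u₂ s₁ s₂ none m₁ m₂ eq₁ eq₂ =
        outcome-↭ (solve 5 (λ x a b c d → (x ⊕ a) ⊕ (b ⊕ (c ⊕ (d ⊕ id′))) ⊜ a ⊕ (b ⊕ (c ⊕ (d ⊕ x)))) ↭-refl (x ∷ []) U₁ U₂ S₁ S₂)
          (search-odd e u₁ u₂ s₁ s₂ (start q) (All.map All.tail m₁) m₂ (suc-injective eq₁) eq₂)
      search-even (suc e) {U₁} {U₂} {S₁} {S₂} {y ∷ l} u₁ u₂ s₁ s₂ (cons r e₀ o) m₁ m₂ eq₁ eq₂ with find₁ r u₁
      ... | inj₁ (x , U , s , ex) with q ∷ u ← ↭.All-resp-↭ s u₁ =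
        outcome-↭ (↭-trans (↭.++⁺ʳ _ s) (solve 6 (λ x a b c d l → (x ⊕ a) ⊕ (b ⊕ (c ⊕ (d ⊕ l))) ⊜ a ⊕ (b ⊕ (c ⊕ (d ⊕ (x ⊕ l)))))
              ↭-refl (x ∷ []) U U₂ S₁ S₂ (y ∷ l)))
          (search-odd e u u₂ s₁ s₂ (step q r ex e₀ o) (All.map (All.tail ∘ ↭.All-resp-↭ s) m₁) m₂
            (suc-injective (trans (sym (↭.↭-length s)) eq₁)) eq₂)
      ... | inj₂ es =
        outcome-↭ (solve 6 (λ y a b c d l → a ⊕ (b ⊕ (c ⊕ (d ⊕ (y ⊕ l)))) ⊜ a ⊕ (b ⊕ (c ⊕ ((y ⊕ d) ⊕ l))))
              ↭-refl (y ∷ []) U₁ U₂ S₁ S₂ l)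
          (search-odd e u₁ u₂ s₁ (r ∷ s₂) o (es ∷ m₁) m₂ (trans eq₁ (sym (+-suc e _))) eq₂)

      search-odd : ∀ e {U₁ U₂ S₁ S₂ x l} → All Q₁ U₁ → All Q₂ U₂ → All Q₁ S₁ → All Q₂ S₂ → Odd b Q₁ Q₂ x l →
        Mono b′ S₂ U₁ → Mono b′ S₁ U₂ → length U₁ ≡ e + length S₂ → length U₂ ≡ suc e + length S₁ →
        Outcome (U₁ ++ U₂ ++ S₁ ++ S₂ ++ l)
      search-odd e {U₁} {U₂} {S₁} {S₂} {x} {l} u₁ u₂ s₁ s₂ o m₁ m₂ eq₁ eq₂ with odd-walk o
      ... | q , _ with find₂ q u₂
      ... | inj₁ (y , U , s , ey) with r ∷ u ← ↭.All-resp-↭ s u₂ =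
        outcome-↭ (↭-trans (↭.++⁺ˡ U₁ (↭.++⁺ʳ _ s))
            (solve 6 (λ y a b c d l → a ⊕ ((y ⊕ b) ⊕ (c ⊕ (d ⊕ l))) ⊜ a ⊕ (b ⊕ (c ⊕ (d ⊕ (y ⊕ l)))))
              ↭-refl (y ∷ []) U₁ U S₁ S₂ l))
          (search-even e u₁ u s₁ s₂ (cons r (E-sym ey) o) m₁ (All.map (All.tail ∘ ↭.All-resp-↭ s) m₂) eq₁
            (suc-injective (trans (sym (↭.↭-length s)) eq₂)))
      ... | inj₂ es with o
      ...   | start _ =
        outcome-↭ (solve 5 (λ x a b c d → a ⊕ (b ⊕ (c ⊕ (d ⊕ x))) ⊜ a ⊕ (b ⊕ ((x ⊕ c) ⊕ (d ⊕ id′)))) ↭-refl (x ∷ []) U₁ U₂ S₁ S₂)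
          (search-even e u₁ u₂ (q ∷ s₁) s₂ none m₁ (es ∷ m₂) eq₁ (trans eq₂ (sym (+-suc e _))))
      ...   | step {y = y} {l = l′} _ r ey e′ o′ =
        outcome-↭ (solve 6 (λ x a b c d l → a ⊕ (b ⊕ (c ⊕ (d ⊕ (x ⊕ l)))) ⊜ a ⊕ (b ⊕ ((x ⊕ c) ⊕ (d ⊕ l))))
              ↭-refl (x ∷ []) U₁ U₂ S₁ S₂ (y ∷ l′))
          (search-even e u₁ u₂ (q ∷ s₁) s₂ (cons r e′ o′) m₁ (es ∷ m₂) eq₁ (trans eq₂ (sym (+-suc e _))))

    search : ∀ {X Y} → All Q₁ X → All Q₂ Y → length X ≡ length Y → Outcome (X ++ Y)
    search {X} {Y} qs rs eq =
      outcome-↭ (↭.++⁺ˡ X (↭-reflexive (sym (++-identityʳ Y))))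
        (search-even (length Y) qs rs [] [] none [] [] (trans eq (sym (+-identityʳ _))) (sym (+-identityʳ _)))

  -- Cycle covers and pieces

  CycleCover : List V → ℕ → Set
  CycleCover L m = ∃ λ (cs : List (Σ Bool λ _ → List V)) →
    length cs ≤ m × All (λ bc → MonoCycle p c (proj₁ bc) (proj₂ bc)) cs × L ↭ concat (map proj₂ cs)

  cover-↭ : ∀ {L L′ m} → L ↭ L′ → CycleCover L′ m → CycleCover L m
  cover-↭ s (cs , len , cyc , t) = cs , len , cyc , ↭-trans s t

  cover-cycle : ∀ b {l L} → MonoCycle p c b l → L ↭ l → CycleCover L 1
  cover-cycle b {l} cyc s = (b , l) ∷ [] , ≤-refl , cyc ∷ [] , ↭-trans s (↭-reflexive (sym (++-identityʳ l)))

  cover-++ : ∀ {L L′ m m′} → CycleCover L m → CycleCover L′ m′ → CycleCover (L ++ L′) (m + m′)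
  cover-++ (cs , len , cyc , s) (cs′ , len′ , cyc′ , s′) =
    cs ++ cs′ , ≤-trans (≤-reflexive (length-++ cs)) (+-mono-≤ len len′) , ++⁺ cyc cyc′ ,
    ↭-trans (↭.++⁺ s s′) (↭-reflexive (trans (concat-++ (map proj₂ cs) (map proj₂ cs′)) (cong concat (sym (map-++ proj₂ cs cs′)))))

  -- Only the ends are constrained, since a piece is linked to K only there. A single vertex is a
  -- piece of either colour.
  record Piece (b : Bool) (Q : V → Set) : Set where
    constructor piece
    field
      {first last} : V
      {vertices}   : List V
      walk         : Walk b first last vertices
      q-first      : Q first
      q-last       : Q last

  open Piece using (vertices)

  verts : ∀ {b Q} → List (Piece b Q) → List V
  verts = concatMap vertices

  verts-++ : ∀ {b Q} (ps qs : List (Piece b Q)) → verts (ps ++ qs) ≡ verts ps ++ verts qs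
  verts-++ = concatMap-++ vertices

  singleton : ∀ {b Q v} → Q v → Piece b Q
  singleton q = piece (stop _) q q

  -- Near and far vertices; linking far pieces

  module Absorption (b : Bool) (θ : ℕ) where

    b′ : Bool
    b′ = not b

    degree : V → List V → ℕ
    degree u K = length (filter (λ v → c u v ≟ᵇ b) K)

    -- Both notions refer to the original K: whenever such a vertex needs a connector, fewer than
    -- `θ` vertices of that side of K are used up. Adjacency is included because `degree` also
    -- counts values of `c` on non-edges.
    Near Far : List V → V → Set
    Near K u = θ ≤ degree u K × All (Adj u) K
    Far  K u = degree u K < θ × All (Adj u) K

    classify : ∀ K {R : V → Set} {X} → All (λ x → All (Adj x) K × R x) X →
      ∃₂ λ N F → X ↭ N ++ F × All (λ x → Near K x × R x) N × All (λ x → Far K x × R x) F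
    classify K [] = [] , [] , ↭-refl , [] , []
    classify K (_∷_ {x} (a , r) as) with N , F , s , ns , fs ← classify K as | θ ≤? degree x K
    ... | yes d = x ∷ N , F , prep x s , ((d , a) , r) ∷ ns , fs
    ... | no ¬d = N , x ∷ F , ↭-trans (prep x s) (↭-sym (↭.shift x N F)) , ns , ((≰⇒> ¬d , a) , r) ∷ fs

    record Rest (K₀ : List V) (r : ℕ) (K : List V) : Set where
      constructor rest
      field
        {used}  : List V
        split   : K₀ ↭ used ++ K
        #used   : length used ≡ r

    rest-cast : ∀ {K₀ r r′ K} → r ≡ r′ → Rest K₀ r K → Rest K₀ r′ K
    rest-cast eq (rest s #u) = rest s (trans #u eq)

    rest-length : ∀ {K₀ r K} → Rest K₀ r K → length K₀ ≡ r + length K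
    rest-length {K = K} (rest {U} s eq) = trans (↭.↭-length s) (trans (length-++ U) (cong (_+ length K) eq))

    degree-split : ∀ {K₀} U K u → K₀ ↭ U ++ K → degree u K₀ ≡ degree u U + degree u K
    degree-split U K u s = trans (↭.↭-length (↭.filter-↭ P? s)) (trans (cong length (filter-++ P? U K)) (length-++ (filter P? U)))
      where P? = λ v → c u v ≟ᵇ b

    Pick : List V → ℕ → List V → (V → Set) → Set
    Pick K₀ r K P = ∃₂ λ k K′ → Rest K₀ (suc r) K′ × K ↭ k ∷ K′ × k ∈ K₀ × P k

    pick : ∀ {K₀ r K P k} → Rest K₀ r K → k ∈ K → (k ∈ K₀ → P k) → Pick K₀ r K P
    pick {k = k} (rest {U} s refl) k∈K pk with K′ , t ← extract k∈K =
      let k∈K₀ = ↭.∈-resp-↭ (↭-sym s) (∈-++⁺ʳ U k∈K)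
      in k , K′ , rest (↭-trans s (↭-trans (↭.++⁺ˡ U t) (↭.shift k U K′))) refl , t , k∈K₀ , pk k∈K₀

    pick-any : ∀ {K₀ r K} → Rest K₀ r K → r < θ → θ + (θ + θ) ≤ length K₀ → Pick K₀ r K (λ _ → ⊤)
    pick-any {K = []} R r<θ big =
      ⊥-elim (<-irrefl (sym (trans (rest-length R) (+-identityʳ _))) (≤-trans r<θ (≤-trans (m≤m+n θ _) big)))
    pick-any {K = k ∷ K} R _ _ = pick R (here refl) _

    -- Fewer than `θ` used vertices cannot include all of the at least `θ` neighbours of `u` in
    -- colour `b`.
    pick-near : ∀ {K₀ r K u} → Rest K₀ r K → r < θ → Near K₀ u → Pick K₀ r K (E b u)
    pick-near {K = K} {u} R@(rest {U} s refl) r<θ (θ≤d , adj) with any? (λ v → c u v ≟ᵇ b) K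
    ... | yes found = let v , v∈K , e = find found in pick R v∈K (λ v∈K₀ → All.lookup adj v∈K₀ , e)
    ... | no ¬found = ⊥-elim (<-irrefl refl (begin-strict
      length U               <⟨ r<θ ⟩
      θ                      ≤⟨ θ≤d ⟩
      _                      ≡⟨ degree-split U K u s ⟩
      degree u U + degree u K ≡⟨ cong (λ l → degree u U + length l) (filter-none _ (¬Any⇒All¬ K ¬found)) ⟩
      degree u U + 0         ≡⟨ +-identityʳ _ ⟩
      degree u U             ≤⟨ length-filter _ U ⟩
      length U               ∎))
      where open ≤-Reasoning

    -- The used vertices, the `b`-neighbours of `u` and those of `v` number fewer than `θ` each, so
    -- they cannot exhaust `θ + (θ + θ)` vertices.
    pick-far : ∀ {K₀ r K u v} → Rest K₀ r K → r < θ → θ + (θ + θ) ≤ length K₀ → Far K₀ u → Far K₀ v →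
      Pick K₀ r K (λ w → E b′ u w × E b′ v w)
    pick-far {K₀} {K = K} {u} {v} R@(rest {U} s refl) r<θ big (d<θ , adj) (d′<θ , adj′)
      with any? (λ w → ¬? (c u w ≟ᵇ b ⊎-dec c v w ≟ᵇ b)) K
    ... | yes found = let w , w∈K , ne = find found in
      pick R w∈K (λ w∈K₀ → (All.lookup adj w∈K₀ , ¬-not (ne ∘ inj₁)) , (All.lookup adj′ w∈K₀ , ¬-not (ne ∘ inj₂)))
    ... | no ¬found = ⊥-elim (<-irrefl refl (begin-strict
      length K₀                                  ≡⟨ rest-length R ⟩
      length U + length K                        ≤⟨ +-monoʳ-≤ (length U) (length-cover (λ w → c u w ≟ᵇ b) (λ w → c v w ≟ᵇ b) (All.map (λ {w} → decidable-stable (c u w ≟ᵇ b ⊎-dec c v w ≟ᵇ b)) (¬Any⇒All¬ K ¬found))) ⟩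
      length U + (degree u K + degree v K)       ≤⟨ +-monoʳ-≤ (length U) (+-mono-≤ (below u) (below v)) ⟩
      length U + (degree u K₀ + degree v K₀)     <⟨ +-mono-< r<θ (+-mono-< d<θ d′<θ) ⟩
      θ + (θ + θ)                                ≤⟨ big ⟩
      length K₀                                  ∎))
      where
      open ≤-Reasoning
      below : ∀ w → degree w K ≤ degree w K₀
      below w = ≤-trans (m≤n+m _ (degree w U)) (≤-reflexive (sym (degree-split U K w s)))

    -- Common `b′`-neighbours link each piece to the next, and a last one links the final end back
    -- to `u`. The cost is exactly one vertex of K per piece, counting the walk at hand; the balance
    -- of the two sides of K depends on this number.
    far-extend : ∀ {K₀ r K u v l} → Walk b′ u v l → Far K₀ u → Far K₀ v → (ps : List (Piece b′ (Far K₀))) →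
      Rest K₀ r K → r + suc (length ps) ≤ θ → θ + (θ + θ) ≤ length K₀ →
      ∃₂ λ l′ K′ → MonoCycle p c b′ l′ × Rest K₀ (r + suc (length ps)) K′ × l ++ verts ps ++ K ↭ l′ ++ K′
    far-extend {r = r} {K} {l = l} w fu fv [] R bound big
      with k , K′ , R′ , s , _ , (eu , ev) ← pick-far R (≤-trans (≤-reflexive (+-comm 1 r)) bound) big fu fv =
      l ++ k ∷ [] , K′ , close (join w ev (stop k)) (E-sym eu) , rest-cast (+-comm 1 r) R′ ,
      ↭-trans (↭.++⁺ˡ l s) (↭-reflexive (sym (++-assoc l _ K′)))
    far-extend {r = r} {K} {l = l} w fu fv (piece {vertices = l₁} w₁ fu₁ fv₁ ∷ ps) R bound big
      with k , K′ , R′ , s , _ , (ev , eu₁) ← pick-far R (≤-trans (m<m+n r (s≤s z≤n)) bound) big fv fu₁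
      with l′ , K″ , cyc , R″ , t ← far-extend (join w ev (E-sym eu₁ ∷ w₁)) fu fv₁ ps R′ (≤-trans (≤-reflexive (sym (+-suc r _))) bound) big =
      l′ , K″ , cyc , rest-cast (sym (+-suc r _)) R″ ,
      ↭-trans (↭.++⁺ˡ l (↭.++⁺ˡ (verts (piece w₁ fu₁ fv₁ ∷ ps)) s))
        (↭-trans (solve 5 (λ k l l₁ v K → l ⊕ ((l₁ ⊕ v) ⊕ (k ⊕ K)) ⊜ (l ⊕ (k ⊕ l₁)) ⊕ (v ⊕ K))
              ↭-refl (k ∷ []) l l₁ (verts ps) K′) t)

    far-cycle : ∀ {K₀ r K} (ps : List (Piece b′ (Far K₀))) → Rest K₀ r K → r + length ps ≤ θ → θ + (θ + θ) ≤ length K₀ →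
      ∃₂ λ l K′ → MonoCycle p c b′ l × Rest K₀ (r + length ps) K′ × verts ps ++ K ↭ l ++ K′
    far-cycle {r = r} {K} [] R _ _ = [] , K , tt , rest-cast (sym (+-identityʳ r)) R , ↭-refl
    far-cycle {K = K} (piece {vertices = l} w fu fv ∷ ps) R bound big
      with l′ , K′ , cyc , R′ , s ← far-extend w fu fv ps R bound big =
      l′ , K′ , cyc , R′ , ↭-trans (↭-reflexive (++-assoc l (verts ps) K)) s

    three-cycles : ∀ {L l l₁ l₂} → MonoCycle p c b l → MonoCycle p c b′ l₁ → MonoCycle p c b′ l₂ →
      L ↭ l ++ l₁ ++ l₂ → CycleCover L 3
    three-cycles {l = l} {l₁} {l₂} cyc cyc₁ cyc₂ s =
      cover-↭ s (cover-++ (cover-cycle b {l} cyc ↭-refl) (cover-++ (cover-cycle b′ {l₁} cyc₁ ↭-refl) (cover-cycle b′ {l₂} cyc₂ ↭-refl)))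

    -- Linking near pieces into one cycle through K

    module Chain {K₁ K₂ : List V} (mono : Mono b K₁ K₂)
      (big₁ : θ + (θ + θ) ≤ length K₁) (big₂ : θ + (θ + θ) ≤ length K₂) where

      edge : ∀ {x y} → x ∈ K₁ → y ∈ K₂ → E b x y
      edge x∈ y∈ = All.lookup (All.lookup mono x∈) y∈

      -- The walk always stops in `K₂`, so every link begins with a step into `K₁`. Exact usage
      -- counts are kept because what remains of K must be balanced at the end.
      Extension : V → List V → ℕ → ℕ → Set
      Extension s L r₁ r₂ = ∃₂ λ e l → ∃₂ λ R₁ R₂ →
        Walk b s e l × e ∈ K₂ × Rest K₁ r₁ R₁ × Rest K₂ r₂ R₂ × L ↭ l ++ R₁ ++ R₂

      extension-cast : ∀ {s L L′ r₁ r₁′ r₂ r₂′} → L ↭ L′ → r₁ ≡ r₁′ → r₂ ≡ r₂′ → Extension s L′ r₁ r₂ → Extension s L r₁′ r₂′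
      extension-cast t eq₁ eq₂ (e , l , R₁ , R₂ , w , e∈ , ρ₁ , ρ₂ , t′) =
        e , l , R₁ , R₂ , w , e∈ , rest-cast eq₁ ρ₁ , rest-cast eq₂ ρ₂ , ↭-trans t t′

      +-suc² : ∀ r m → r + suc (suc m) ≡ suc (suc r) + m
      +-suc² r m = trans (+-suc r (suc m)) (cong suc (+-suc r m))

      -- The link runs through `e`, `x`, `y`, the piece and `z`. As `e` and the neighbours `y`, `z`
      -- of the piece are all in `K₂`, the detour over `x` in `K₁` is made: one vertex of `K₁` and
      -- two of `K₂` are spent.
      near₂-extend : ∀ {s e l r₁ r₂ R₁ R₂} → Walk b s e l → e ∈ K₂ → (ps : List (Piece b (Near K₂))) →
        Rest K₁ r₁ R₁ → Rest K₂ r₂ R₂ → r₁ + length ps ≤ θ → r₂ + length ps * 2 ≤ θ →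
        Extension s (l ++ verts ps ++ R₁ ++ R₂) (r₁ + length ps) (r₂ + length ps * 2)
      near₂-extend w e∈ [] ρ₁ ρ₂ _ _ =
        extension-cast ↭-refl (sym (+-identityʳ _)) (sym (+-identityʳ _)) (_ , _ , _ , _ , w , e∈ , ρ₁ , ρ₂ , ↭-refl)
      near₂-extend {l = l} {r₁} {r₂} {R₁} {R₂} w e∈ (piece {vertices = l₁} w₁ nu nv ∷ ps) ρ₁ ρ₂ b₁ b₂
        with x , R₁′ , ρ₁′ , s₁ , x∈ , _ ← pick-any ρ₁ (≤-trans (m<m+n r₁ (s≤s z≤n)) b₁) big₁
        with b₂′ ← ≤-trans (≤-reflexive (sym (+-suc² r₂ (length ps * 2)))) b₂
        with y , R₂′ , ρ₂′ , s₂ , y∈ , ey ← pick-near ρ₂ (≤-trans (n≤1+n _) (≤-trans (m≤m+n _ _) b₂′)) nu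
        with z , R₂″ , ρ₂″ , s₃ , z∈ , ez ← pick-near ρ₂′ (≤-trans (m≤m+n _ _) b₂′) nv =
        extension-cast
          (↭-trans (↭.++⁺ˡ l (↭.++⁺ˡ (verts (piece w₁ nu nv ∷ ps)) (↭.++⁺ s₁ (↭-trans s₂ (prep y s₃)))))
            (solve 8 (λ l l₁ v x y z R₁ R₂ → l ⊕ ((l₁ ⊕ v) ⊕ ((x ⊕ R₁) ⊕ (y ⊕ (z ⊕ R₂)))) ⊜ (l ⊕ (x ⊕ (y ⊕ (l₁ ⊕ z)))) ⊕ (v ⊕ (R₁ ⊕ R₂)))
              ↭-refl l l₁ (verts ps) (x ∷ []) (y ∷ []) (z ∷ []) R₁′ R₂″))
          (sym (+-suc r₁ _)) (sym (+-suc² r₂ _))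
          (near₂-extend (join w (E-sym (edge x∈ e∈)) (edge x∈ y∈ ∷ E-sym ey ∷ join w₁ ez (stop z))) z∈ ps ρ₁′ ρ₂″
            (≤-trans (≤-reflexive (sym (+-suc r₁ _))) b₁) b₂′)

      -- Here the neighbours `x`, `y` of the piece are in `K₁`, so `e` reaches `x` directly and `z`
      -- brings the walk back to `K₂`. The costs are exchanged.
      near₁-extend : ∀ {s e l r₁ r₂ R₁ R₂} → Walk b s e l → e ∈ K₂ → (ps : List (Piece b (Near K₁))) →
        Rest K₁ r₁ R₁ → Rest K₂ r₂ R₂ → r₁ + length ps * 2 ≤ θ → r₂ + length ps ≤ θ →
        Extension s (l ++ verts ps ++ R₁ ++ R₂) (r₁ + length ps * 2) (r₂ + length ps)
      near₁-extend w e∈ [] ρ₁ ρ₂ _ _ =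
        extension-cast ↭-refl (sym (+-identityʳ _)) (sym (+-identityʳ _)) (_ , _ , _ , _ , w , e∈ , ρ₁ , ρ₂ , ↭-refl)
      near₁-extend {l = l} {r₁} {r₂} {R₁} {R₂} w e∈ (piece {vertices = l₁} w₁ nu nv ∷ ps) ρ₁ ρ₂ b₁ b₂
        with z , R₂′ , ρ₂′ , s₁ , z∈ , _ ← pick-any ρ₂ (≤-trans (m<m+n r₂ (s≤s z≤n)) b₂) big₂
        with b₁′ ← ≤-trans (≤-reflexive (sym (+-suc² r₁ (length ps * 2)))) b₁
        with x , R₁′ , ρ₁′ , s₂ , x∈ , ex ← pick-near ρ₁ (≤-trans (n≤1+n _) (≤-trans (m≤m+n _ _) b₁′)) nu
        with y , R₁″ , ρ₁″ , s₃ , y∈ , ey ← pick-near ρ₁′ (≤-trans (m≤m+n _ _) b₁′) nv =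
        extension-cast
          (↭-trans (↭.++⁺ˡ l (↭.++⁺ˡ (verts (piece w₁ nu nv ∷ ps)) (↭.++⁺ (↭-trans s₂ (prep x s₃)) s₁)))
            (solve 8 (λ l l₁ v x y z R₁ R₂ → l ⊕ ((l₁ ⊕ v) ⊕ ((x ⊕ (y ⊕ R₁)) ⊕ (z ⊕ R₂))) ⊜ (l ⊕ (x ⊕ (l₁ ⊕ (y ⊕ z)))) ⊕ (v ⊕ (R₁ ⊕ R₂)))
              ↭-refl l l₁ (verts ps) (x ∷ []) (y ∷ []) (z ∷ []) R₁″ R₂′))
          (sym (+-suc² r₁ _)) (sym (+-suc r₂ _))
          (near₁-extend (join w (E-sym (edge x∈ e∈)) (E-sym ex ∷ join w₁ ey (edge y∈ z∈ ∷ stop z))) z∈ ps ρ₁″ ρ₂′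
            b₁′ (≤-trans (≤-reflexive (sym (+-suc r₂ _))) b₂))

      finish : ∀ {s e l R₁ R₂} → Walk b s e l → s ∈ K₁ → e ∈ K₂ → All (_∈ K₁) R₁ → All (_∈ K₂) R₂ → length R₁ ≡ length R₂ →
        ∃ λ l′ → MonoCycle p c b l′ × l ++ R₁ ++ R₂ ↭ l′
      finish {l = l} {[]} {[]} w s∈ e∈ _ _ _ = l , close w (E-sym (edge s∈ e∈)) , ↭-reflexive (++-identityʳ l)
      finish {l = l} {x ∷ R₁} {y ∷ R₂} w s∈ e∈ (x∈ ∷ xs) (y∈ ∷ ys) eq
        with l′ , cyc , s ← finish (join w (E-sym (edge x∈ e∈)) (edge x∈ y∈ ∷ stop y)) s∈ y∈ xs ys (suc-injective eq) =
        l′ , cyc , ↭-trans (solve 5 (λ l x y R₁ R₂ → l ⊕ ((x ⊕ R₁) ⊕ (y ⊕ R₂)) ⊜ (l ⊕ (x ⊕ y)) ⊕ (R₁ ⊕ R₂))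
              ↭-refl l (x ∷ []) (y ∷ []) R₁ R₂) s

      rest-∈ : ∀ {K r R} → Rest K r R → All (_∈ K) R
      rest-∈ (rest {U} s _) = ++⁻ʳ U (↭.All-resp-↭ s (All.tabulate id))

      -- The far pieces of each side form a `b′`-cycle; the near pieces and the rest of K form a
      -- `b`-cycle. A piece attached to `K₂` takes one vertex more from `K₂` than from `K₁`, be it
      -- near (two against one) or far (one against none), and conversely. Equal numbers of pieces
      -- therefore leave equal remainders.
      absorb : (nx : List (Piece b (Near K₂))) (fx : List (Piece b′ (Far K₂)))
        (ny : List (Piece b (Near K₁))) (fy : List (Piece b′ (Far K₁))) →
        length K₁ ≡ length K₂ → length nx + length fx ≡ length ny + length fy → 3 * (length nx + length fx) < θ →
        CycleCover (K₁ ++ K₂ ++ verts nx ++ verts fx ++ verts ny ++ verts fy) 3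
      absorb nx fx ny fy K-eq eq bound
        with balance , B₁ , B₂ ← connector-count (length nx) (length fx) (length ny) (length fy) eq bound
        with f< ← ≤-trans (s≤s (≤-trans (m≤m+n (length fx) _) (m≤m+n _ (length ny)))) B₂
        with f′< ← ≤-trans (s≤s (≤-trans (m≤m+n (length fy) _) (m≤m+n _ (length ny * 2)))) B₁
        with l₂ , R₂ , cyc₂ , ρ₂ , s₂ ← far-cycle fx (rest {used = []} ↭-refl refl) (<⇒≤ f<) big₂
        with l₁ , R₁ , cyc₁ , ρ₁ , s₁ ← far-cycle fy (rest {used = []} ↭-refl refl) (<⇒≤ f′<) big₁
        -- An edge of K starts the `b`-walk; its ends are the two vertices that `connector-count`
        -- leaves out.
        with x , R₁′ , ρ₁′ , t₁ , x∈ , _ ← pick-any ρ₁ f′< big₁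
        with y , R₂′ , ρ₂′ , t₂ , y∈ , _ ← pick-any ρ₂ f< big₂
        with e , m , R₁″ , R₂″ , w , e∈ , ρ₁″ , ρ₂″ , t₃ ← near₂-extend (edge x∈ y∈ ∷ stop y) y∈ nx ρ₁′ ρ₂′ (≤-trans (m≤m+n _ _) B₁) (≤-trans (m≤m+n _ _) B₂)
        with e′ , m′ , R₁‴ , R₂‴ , w′ , e∈′ , ρ₁‴ , ρ₂‴ , t₄ ← near₁-extend w e∈ ny ρ₁″ ρ₂″ B₁ B₂
        with l , cyc , t₅ ← finish w′ x∈ e∈′ (rest-∈ ρ₁‴) (rest-∈ ρ₂‴)
               (+-cancelˡ-≡ (suc (length fx + length nx * 2 + length ny)) _ _ (trans (cong (_+ length R₁‴) (cong suc (sym balance)))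
                 (trans (sym (rest-length ρ₁‴)) (trans K-eq (rest-length ρ₂‴))))) =
        three-cycles {l = l} {l₁} {l₂} cyc cyc₁ cyc₂ (begin
          K₁ ++ K₂ ++ NX ++ FX ++ NY ++ FY
            ↭⟨ solve 6 (λ K₁ K₂ NX FX NY FY → K₁ ⊕ (K₂ ⊕ (NX ⊕ (FX ⊕ (NY ⊕ FY)))) ⊜ (FY ⊕ K₁) ⊕ ((FX ⊕ K₂) ⊕ (NX ⊕ NY)))
                  ↭-refl K₁ K₂ NX FX NY FY ⟩
          (FY ++ K₁) ++ (FX ++ K₂) ++ NX ++ NY
            ↭⟨ ↭.++⁺ (↭-trans s₁ (↭.++⁺ˡ l₁ t₁)) (↭.++⁺ʳ (NX ++ NY) (↭-trans s₂ (↭.++⁺ˡ l₂ t₂))) ⟩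
          (l₁ ++ x ∷ R₁′) ++ (l₂ ++ y ∷ R₂′) ++ NX ++ NY
            ↭⟨ solve 8 (λ l₁ l₂ x y R₁ R₂ NX NY → (l₁ ⊕ (x ⊕ R₁)) ⊕ ((l₂ ⊕ (y ⊕ R₂)) ⊕ (NX ⊕ NY)) ⊜ ((x ⊕ y) ⊕ (NX ⊕ (R₁ ⊕ R₂))) ⊕ (NY ⊕ (l₁ ⊕ l₂)))
                 ↭-refl l₁ l₂ (x ∷ []) (y ∷ []) R₁′ R₂′ NX NY ⟩
          ((x ∷ y ∷ []) ++ NX ++ R₁′ ++ R₂′) ++ NY ++ l₁ ++ l₂
            ↭⟨ ↭.++⁺ʳ (NY ++ l₁ ++ l₂) t₃ ⟩
          (m ++ R₁″ ++ R₂″) ++ NY ++ l₁ ++ l₂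
            ↭⟨ solve 5 (λ m R₁ R₂ NY l → (m ⊕ (R₁ ⊕ R₂)) ⊕ (NY ⊕ l) ⊜ (m ⊕ (NY ⊕ (R₁ ⊕ R₂))) ⊕ l) ↭-refl m R₁″ R₂″ NY (l₁ ++ l₂) ⟩
          (m ++ NY ++ R₁″ ++ R₂″) ++ l₁ ++ l₂
            ↭⟨ ↭.++⁺ʳ (l₁ ++ l₂) (↭-trans t₄ t₅) ⟩
          l ++ l₁ ++ l₂ ∎)
        where
        open PermutationReasoning
        NX = verts nx
        FX = verts fx
        NY = verts ny
        FY = verts fy

  -- Cutting bipartite graphs into pieces

  Cut : (b b′ : Bool) (Q₁ Q₂ : V → Set) → ℕ → List V → Set
  Cut b b′ Q₁ Q₂ q L = ∃₂ λ (ps : List (Piece b Q₁)) (ss : List (Piece b′ Q₂)) →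
    length ps ≡ length ss × length ps ≤ q × L ↭ verts ps ++ verts ss

  cut-sym : ∀ {b b′ Q₁ Q₂ q L} → Cut b b′ Q₁ Q₂ q L → Cut b′ b Q₂ Q₁ q L
  cut-sym (ps , ss , eq , len , s) =
    ss , ps , sym eq , ≤-trans (≤-reflexive (sym eq)) len , ↭-trans s (↭.++-comm (verts ps) (verts ss))

  cut-↭ : ∀ {b b′ Q₁ Q₂ q L L′} → L ↭ L′ → Cut b b′ Q₁ Q₂ q L′ → Cut b b′ Q₁ Q₂ q L
  cut-↭ s (ps , ss , eq , len , t) = ps , ss , eq , len , ↭-trans s t

  cut-++ : ∀ {b b′ Q₁ Q₂ q q′ L L′} → Cut b b′ Q₁ Q₂ q L → Cut b b′ Q₁ Q₂ q′ L′ → Cut b b′ Q₁ Q₂ (q + q′) (L ++ L′)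
  cut-++ (ps , ss , eq , len , s) (ps′ , ss′ , eq′ , len′ , s′) =
    ps ++ ps′ , ss ++ ss′ ,
    trans (length-++ ps) (trans (cong₂ _+_ eq eq′) (sym (length-++ ss))) ,
    ≤-trans (≤-reflexive (length-++ ps)) (+-mono-≤ len len′) ,
    ↭-trans (↭.++⁺ s s′)
      (↭-trans (solve 4 (λ a b c d → (a ⊕ b) ⊕ (c ⊕ d) ⊜ (a ⊕ c) ⊕ (b ⊕ d)) ↭-refl (verts ps) (verts ss) (verts ps′) (verts ss′))
        (↭-reflexive (sym (cong₂ _++_ (verts-++ ps ps′) (verts-++ ss ss′)))))

  -- An even walk has one end on each side; removing its first vertex leaves a walk with both ends on side Q₁.
  cut-even : ∀ {b b′ Q₁ Q₂ P₁ P₂ l} → (∀ {v} → Q₁ v → P₁ v) → (∀ {v} → Q₂ v → P₂ v) → Even b Q₁ Q₂ l → Cut b b′ P₁ P₂ 1 l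
  cut-even _ _ none = [] , [] , refl , z≤n , ↭-refl
  cut-even f g (cons {y} {l = l} r _ o) with q , _ , q′ , w ← odd-walk o =
    piece w (f q) (f q′) ∷ [] , singleton (g r) ∷ [] , refl , ≤-refl ,
    solve 2 (λ y l → y ⊕ l ⊜ (l ⊕ id′) ⊕ (y ⊕ id′)) ↭-refl (y ∷ []) l

  module _ {Q₁ Q₂ P₁ P₂ : V → Set} (f : ∀ {v} → Q₁ v → P₁ v) (g : ∀ {v} → Q₂ v → P₂ v) {A D : List V}
    (as : All Q₁ A) (ds : All Q₂ D) (eq : length A ≡ length D) where

    -- The search follows `b′` with `D` as first side, so its walk gives a `b′`-piece with ends in
    -- `D` and a single vertex of `A`. The two blobs have colour `b`; each gives a `b`-piece with
    -- ends in `A` and a single vertex of `D`. Every colour fits, so no cycle is spent.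
    cut-mixed : ∀ {b b′} → (∀ {x y} → Q₂ x → Q₁ y → E b′ x y ⊎ E b x y) → Cut b b′ P₁ P₂ 3 (A ++ D)
    cut-mixed cases with l , M , N , o , B , B′ , s ← Search.search cases ds as (sym eq)
      with m , tm , om , _ ← blob-cycle (blob-sym B) | n , tn , on , _ ← blob-cycle (blob-sym B′) =
      cut-↭ (↭-trans (↭.++-comm A D) (↭-trans s (↭.++⁺ˡ l (↭.++⁺ tm tn))))
        (cut-++ (cut-sym (cut-even g f o)) (cut-++ (cut-even f g om) (cut-even f g on)))

    -- Both sides want colour `b`. The walk becomes pieces, but the blobs have the wrong colour and
    -- are closed into two cycles.
    cut-pure : ∀ {b b′} → (∀ {x y} → Q₁ x → Q₂ y → E b x y ⊎ E b′ x y) →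
      ∃₂ λ L M → Cut b b P₁ P₂ 1 L × CycleCover M 2 × A ++ D ↭ L ++ M
    cut-pure {b} {b′} cases with l , M , N , o , B , B′ , s ← Search.search cases as ds eq
      with m , tm , _ , cyc ← blob-cycle B | n , tn , _ , cyc′ ← blob-cycle B′ =
      l , M ++ N , cut-even f g o , cover-++ (cover-cycle b′ cyc tm) (cover-cycle b′ cyc′ tn) , s

  -- Balanced decompositions into pieces and cycles

  -- A piece with both ends on one side has exactly one surplus vertex on that side, so size says that L is balanced.
  -- Vertices of side 1 will be attached to K₂ and vertices of side 2 to K₁.
  record Decomposition (b : Bool) (N₁ F₁ N₂ F₂ : V → Set) (m q : ℕ) (L : List V) : Set where
    constructor decomposition
    field
      near₁ : List (Piece b N₁)
      far₁  : List (Piece (not b) F₁)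
      near₂ : List (Piece b N₂)
      far₂  : List (Piece (not b) F₂)
      {remainder} : List V
      cover : CycleCover remainder m
      size  : length near₁ + length far₁ ≡ length near₂ + length far₂
      bound : length near₁ + length far₁ ≤ q
      split : L ↭ verts near₁ ++ verts far₁ ++ verts near₂ ++ verts far₂ ++ remainder

  no-cover : CycleCover [] 0
  no-cover = [] , z≤n , [] , ↭-refl

  module _ {b : Bool} {N₁ F₁ N₂ F₂ : V → Set} where

    private D = Decomposition b N₁ F₁ N₂ F₂

    _⊞_ : ∀ {m m′ q q′ L L′} → D m q L → D m′ q′ L′ → D (m + m′) (q + q′) (L ++ L′)
    decomposition a f a₂ f₂ {M} cov eq bd s ⊞ decomposition a′ f′ a₂′ f₂′ {M′} cov′ eq′ bd′ s′ =
      decomposition (a ++ a′) (f ++ f′) (a₂ ++ a₂′) (f₂ ++ f₂′) (cover-++ cov cov′)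
        (trans (lengths a a′ f f′) (trans (cong₂ _+_ eq eq′) (sym (lengths a₂ a₂′ f₂ f₂′))))
        (≤-trans (≤-reflexive (lengths a a′ f f′)) (+-mono-≤ bd bd′))
        (↭-trans (↭.++⁺ s s′) (↭-trans
          (solve 10 (λ a f a₂ f₂ M a′ f′ a₂′ f₂′ M′ →
              (a ⊕ (f ⊕ (a₂ ⊕ (f₂ ⊕ M)))) ⊕ (a′ ⊕ (f′ ⊕ (a₂′ ⊕ (f₂′ ⊕ M′)))) ⊜
              (a ⊕ a′) ⊕ ((f ⊕ f′) ⊕ ((a₂ ⊕ a₂′) ⊕ ((f₂ ⊕ f₂′) ⊕ (M ⊕ M′))))) ↭-refl
            (verts a) (verts f) (verts a₂) (verts f₂) M (verts a′) (verts f′) (verts a₂′) (verts f₂′) M′)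
          (↭-reflexive (sym (cong₂ _++_ (verts-++ a a′) (cong₂ _++_ (verts-++ f f′)
            (cong₂ _++_ (verts-++ a₂ a₂′) (cong (_++ M ++ M′) (verts-++ f₂ f₂′)))))))))
      where
      lengths : ∀ {b b′ P Q} (x x′ : List (Piece b P)) (y y′ : List (Piece b′ Q)) →
        length (x ++ x′) + length (y ++ y′) ≡ (length x + length y) + (length x′ + length y′)
      lengths x x′ y y′ = trans (cong₂ _+_ (length-++ x) (length-++ y))
        (ring 4 (λ x x′ y y′ → (x :+ x′) :+ (y :+ y′) := (x :+ y) :+ (x′ :+ y′)) refl (length x) (length x′) (length y) (length y′))
        where open +-*-Solver using (_:+_; _:=_) renaming (solve to ring)

    decomposition-↭ : ∀ {m q L L′} → L ↭ L′ → D m q L′ → D m q L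
    decomposition-↭ s (decomposition a f a₂ f₂ cov eq bd t) = decomposition a f a₂ f₂ cov eq bd (↭-trans s t)

    from-near₁-far₂ : ∀ {q L} → Cut b (not b) N₁ F₂ q L → D 0 q L
    from-near₁-far₂ (ps , ss , eq , bd , s) =
      decomposition ps [] [] ss no-cover (trans (+-identityʳ _) eq) (≤-trans (≤-reflexive (+-identityʳ _)) bd)
        (↭-trans s (↭.++⁺ˡ (verts ps) (↭-reflexive (sym (++-identityʳ _)))))

    from-near₂-far₁ : ∀ {q L} → Cut b (not b) N₂ F₁ q L → D 0 q L
    from-near₂-far₁ (ps , ss , eq , bd , s) =
      decomposition [] ss ps [] no-cover (trans (sym eq) (sym (+-identityʳ _))) (≤-trans (≤-reflexive (sym eq)) bd)
        (↭-trans s (↭-trans (↭.++-comm (verts ps) _) (↭.++⁺ˡ (verts ss) (↭-reflexive (sym (++-identityʳ _))))))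

    from-near : ∀ {q L} → Cut b b N₁ N₂ q L → D 0 q L
    from-near (ps , ss , eq , bd , s) =
      decomposition ps [] ss [] no-cover (cong (_+ 0) eq) (≤-trans (≤-reflexive (+-identityʳ _)) bd)
        (↭-trans s (↭.++⁺ˡ (verts ps) (↭-reflexive (sym (++-identityʳ _)))))

    from-far : ∀ {q L} → Cut (not b) (not b) F₁ F₂ q L → D 0 q L
    from-far (ps , ss , eq , bd , s) =
      decomposition [] ps [] ss no-cover eq bd (↭-trans s (↭.++⁺ˡ (verts ps) (↭-reflexive (sym (++-identityʳ _)))))

    from-cover : ∀ {m L} → CycleCover L m → D m 0 L
    from-cover cov = decomposition [] [] [] [] cov refl z≤n ↭-refl

  Joined : List V → List V → Set
  Joined X Y = ∀ {x y} → x ∈ X → y ∈ Y → Adj x y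

  joined-sym : ∀ {X Y} → Joined X Y → Joined Y X
  joined-sym j y∈ x∈ = j x∈ y∈ ∘ sym

  -- Decomposing one bipartite region

  module Regions (b : Bool) (θ : ℕ) where
    open Absorption b θ hiding (b′)

    module _ {K₁ K₂ X Y : List V} (j : Joined X Y) where

      private
        -- The 2 cycles come from one `cut-pure`; 7 is 3 + 3 from two uses of `cut-mixed` plus 1
        -- from `cut-pure`.
        Goal : List V → Set
        Goal = Decomposition b (Near K₂) (Far K₂) (Near K₁) (Far K₁) 2 7

        _within_ : (V → Set) → List V → V → Set
        (P within L) v = P v × v ∈ L

        cases : ∀ {P Q x y} → (P within X) x → (Q within Y) y → E b x y ⊎ E (not b) x y
        cases (_ , x∈) (_ , y∈) = E-cases b (j x∈ y∈)

        cases′ : ∀ {P Q x y} → (P within Y) x → (Q within X) y → E b x y ⊎ E (not b) x y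
        cases′ (_ , x∈) (_ , y∈) = E-cases b (j y∈ x∈ ∘ sym)

      near-heavy : ∀ X₁ Y₁ {X₂ F Y₂ F′} →
        All (Near K₂ within X) (X₁ ++ X₂) → All (Far K₂ within X) F → All (Near K₁ within Y) (Y₁ ++ Y₂) → All (Far K₁ within Y) F′ →
        length X₁ ≡ length F′ → length Y₁ ≡ length F → length X₂ ≡ length Y₂ → Goal (((X₁ ++ X₂) ++ F) ++ ((Y₁ ++ Y₂) ++ F′))
      near-heavy X₁ Y₁ {X₂} {F} {Y₂} {F′} ns fs ns′ fs′ e e′ e″
        with L , M , pure , cov , t ← cut-pure {P₁ = Near K₂} {P₂ = Near K₁} proj₁ proj₁ (++⁻ʳ X₁ ns) (++⁻ʳ Y₁ ns′) e″ (cases {Near K₂} {Near K₁}) =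
        decomposition-↭
          (↭-trans (solve 6 (λ X₁ X₂ F Y₁ Y₂ F′ → ((X₁ ⊕ X₂) ⊕ F) ⊕ ((Y₁ ⊕ Y₂) ⊕ F′) ⊜ (X₁ ⊕ F′) ⊕ ((Y₁ ⊕ F) ⊕ (X₂ ⊕ Y₂)))
                ↭-refl X₁ X₂ F Y₁ Y₂ F′)
            (↭.++⁺ˡ (X₁ ++ F′) (↭.++⁺ˡ (Y₁ ++ F) t)))
          (from-near₁-far₂ (cut-mixed proj₁ proj₁ (++⁻ˡ X₁ ns) fs′ e (λ q r → swap (cases′ {Far K₁} {Near K₂} q r))) ⊞
          (from-near₂-far₁ (cut-mixed proj₁ proj₁ (++⁻ˡ Y₁ ns′) fs e′ (λ q r → swap (cases {Far K₂} {Near K₁} q r))) ⊞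
          (from-near pure ⊞ from-cover cov)))

      far-heavy : ∀ X₁ Y₁ {N X₂ N′ Y₂} →
        All (Near K₂ within X) N → All (Far K₂ within X) (X₁ ++ X₂) → All (Near K₁ within Y) N′ → All (Far K₁ within Y) (Y₁ ++ Y₂) →
        length N ≡ length Y₁ → length N′ ≡ length X₁ → length X₂ ≡ length Y₂ → Goal ((N ++ (X₁ ++ X₂)) ++ (N′ ++ (Y₁ ++ Y₂)))
      far-heavy X₁ Y₁ {N} {X₂} {N′} {Y₂} ns fs ns′ fs′ e e′ e″
        with L , M , pure , cov , t ← cut-pure {P₁ = Far K₂} {P₂ = Far K₁} proj₁ proj₁ (++⁻ʳ X₁ fs) (++⁻ʳ Y₁ fs′) e″ (λ q r → swap (cases {Far K₂} {Far K₁} q r)) =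
        decomposition-↭
          (↭-trans (solve 6 (λ N X₁ X₂ N′ Y₁ Y₂ → (N ⊕ (X₁ ⊕ X₂)) ⊕ (N′ ⊕ (Y₁ ⊕ Y₂)) ⊜ (N ⊕ Y₁) ⊕ ((N′ ⊕ X₁) ⊕ (X₂ ⊕ Y₂)))
                ↭-refl N X₁ X₂ N′ Y₁ Y₂)
            (↭.++⁺ˡ (N ++ Y₁) (↭.++⁺ˡ (N′ ++ X₁) t)))
          (from-near₁-far₂ (cut-mixed proj₁ proj₁ ns (++⁻ˡ Y₁ fs′) e (λ q r → swap (cases′ {Far K₁} {Near K₂} q r))) ⊞
          (from-near₂-far₁ (cut-mixed proj₁ proj₁ ns′ (++⁻ˡ X₁ fs) e′ (λ q r → swap (cases {Far K₂} {Near K₁} q r))) ⊞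
          (from-far pure ⊞ from-cover cov)))

      -- By the count, the surplus of `N` over `F′` equals that of `N′` over `F`. So once near
      -- vertices are matched with far ones across, the unmatched vertices are balanced, and all
      -- near or all far.
      combine : ∀ {N F N′ F′} →
        All (Near K₂ within X) N → All (Far K₂ within X) F → All (Near K₁ within Y) N′ → All (Far K₁ within Y) F′ →
        length N + length F ≡ length N′ + length F′ → Goal ((N ++ F) ++ (N′ ++ F′))
      combine {N} {F} {N′} {F′} ns fs ns′ fs′ counts with ≤-total (length F′) (length N)
      ... | inj₁ le
        with X₁ , X₂ , refl , e ← split-at (length F′) {N} le
        with e′ ← length-drop-prefix (length F′) X₁ e counts
        with Y₁ , Y₂ , refl , e″ ← split-at (length F) {N′} (≤-trans (m≤n+m _ (length X₂)) (≤-reflexive e′)) =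
        near-heavy X₁ Y₁ ns fs ns′ fs′ e e″ (+-cancelʳ-≡ (length F) _ _ (trans e′ (trans (length-++ Y₁) (trans (cong (_+ length Y₂) e″) (+-comm (length F) _)))))
      ... | inj₂ le
        with Y₁ , Y₂ , refl , e ← split-at (length N) {F′} le
        with e′ ← length-drop-prefix (length N) Y₁ e (trans (+-comm _ (length N′)) (trans (sym counts) (+-comm (length N) _)))
        with X₁ , X₂ , refl , e″ ← split-at (length N′) {F} (≤-trans (m≤n+m _ (length Y₂)) (≤-reflexive e′)) =
        far-heavy X₁ Y₁ ns fs ns′ fs′ (sym e) (sym e″)
          (sym (+-cancelʳ-≡ (length N′) _ _ (trans e′ (trans (length-++ X₁) (trans (cong (_+ length X₂) e″) (+-comm (length N′) _))))))

      region : Joined X K₂ → Joined Y K₁ → length X ≡ length Y → Goal (X ++ Y)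
      region jX jY eq
        with N , F , s , ns , fs ← classify K₂ (All.tabulate (λ x∈ → All.tabulate (jX x∈) , x∈))
        with N′ , F′ , s′ , ns′ , fs′ ← classify K₁ (All.tabulate (λ y∈ → All.tabulate (jY y∈) , y∈)) =
        decomposition-↭ (↭.++⁺ s s′) (combine ns fs ns′ fs′
          (trans (sym (length-++ N)) (trans (sym (↭.↭-length s)) (trans eq (trans (↭.↭-length s′) (length-++ N′))))))

    assemble : ∀ {K₁ K₂ L m q} → Mono b K₁ K₂ → length K₁ ≡ length K₂ → θ + (θ + θ) ≤ length K₂ → 3 * q < θ →
      Decomposition b (Near K₂) (Far K₂) (Near K₁) (Far K₁) m q L → CycleCover (K₁ ++ K₂ ++ L) (3 + m)
    assemble {K₁} {K₂} mono eq big q<θ (decomposition a f a′ f′ {M} cov size bound s) =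
      cover-↭
        (↭-trans (↭.++⁺ˡ K₁ (↭.++⁺ˡ K₂ s))
          (solve 7 (λ K₁ K₂ a f a′ f′ M → K₁ ⊕ (K₂ ⊕ (a ⊕ (f ⊕ (a′ ⊕ (f′ ⊕ M))))) ⊜ (K₁ ⊕ (K₂ ⊕ (a ⊕ (f ⊕ (a′ ⊕ f′))))) ⊕ M)
            ↭-refl K₁ K₂ (verts a) (verts f) (verts a′) (verts f′) M))
        (cover-++ (Chain.absorb mono (subst (_ ≤_) (sym eq) big) big a f a′ f′ eq size (≤-<-trans (*-monoʳ-≤ 3 bound) q<θ)) cov)

  -- Bipartite Ramsey theorem

  record MonoPair (b : Bool) (m t : ℕ) (X Y : List V) : Set where
    constructor mono-pair
    field
      {K₁ K₂ X′ Y′} : List V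
      splitX : X ↭ K₁ ++ X′
      splitY : Y ↭ K₂ ++ Y′
      mono   : Mono b K₁ K₂
      #K₁    : length K₁ ≡ m
      #K₂    : t ≤ length K₂

  colour-classes : ∀ {x Y} → All (Adj x) Y → ∃₂ λ Y₁ Y₂ → Y ↭ Y₁ ++ Y₂ × All (E true x) Y₁ × All (E false x) Y₂
  colour-classes [] = [] , [] , ↭-refl , [] , []
  colour-classes {Y = y ∷ _} (a ∷ as) with Y₁ , Y₂ , s , es , es′ ← colour-classes as | E-cases true a
  ... | inj₁ e = y ∷ Y₁ , Y₂ , prep y s , e ∷ es , es′
  ... | inj₂ e = Y₁ , y ∷ Y₂ , ↭-trans (prep y s) (↭-sym (↭.shift y Y₁ Y₂)) , es , e ∷ es′

  extend-pair : ∀ {b m t x X Y Y₁ Y₂} → Y ↭ Y₁ ++ Y₂ → All (E b x) Y₁ → MonoPair b m t X Y₁ → MonoPair b (suc m) t (x ∷ X) Y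
  extend-pair {x = x} {Y₂ = Y₂} s es (mono-pair {K₁} {K₂} {X′} {Y′} sx sy mono e le) =
    mono-pair {K₁ = x ∷ K₁} (prep x sx) (↭-trans s (↭-trans (↭.++⁺ʳ Y₂ sy) (↭-reflexive (++-assoc K₂ Y′ Y₂))))
      (++⁻ˡ K₂ (↭.All-resp-↭ sy es) ∷ mono) (cong suc e) le

  weaken-pair : ∀ {b m t x X Y Y₁ Y₂} → Y ↭ Y₁ ++ Y₂ → MonoPair b m t X Y₁ → MonoPair b m t (x ∷ X) Y
  weaken-pair {x = x} {Y₂ = Y₂} s (mono-pair {K₁} {K₂} {X′} {Y′} sx sy mono e le) =
    mono-pair (↭-trans (prep x sx) (↭-sym (↭.shift x K₁ X′)))
      (↭-trans s (↭-trans (↭.++⁺ʳ Y₂ sy) (↭-reflexive (++-assoc K₂ Y′ Y₂)))) mono e le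

  -- Each vertex of `X` keeps a colour class holding at least half of the current `Y` and is
  -- recorded under its colour. Within `r + s` vertices one colour has its quota, and `Y` was halved
  -- at most that often.
  ramsey : ∀ r s t {X Y} → Joined X Y → r + s ≤ length X → 2 ^ (r + s) * t ≤ length Y →
    MonoPair true r t X Y ⊎ MonoPair false s t X Y
  ramsey zero s t {Y = Y} _ _ le = inj₁ (mono-pair {K₂ = Y} {Y′ = []} ↭-refl (↭-reflexive (sym (++-identityʳ _))) [] refl (≤-trans (m≤n*m t (2 ^ s) {{m^n≢0 2 s}}) le))
  ramsey (suc r) zero t {Y = Y} _ _ le = inj₂ (mono-pair {K₂ = Y} {Y′ = []} ↭-refl (↭-reflexive (sym (++-identityʳ _))) [] refl (≤-trans (m≤n*m t (2 ^ suc (r + 0)) {{m^n≢0 2 (suc (r + 0))}}) le))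
  ramsey (suc r) (suc s) t {x ∷ X} {Y} j (s≤s lx) ly
    with Y₁ , Y₂ , split , es , es′ ← colour-classes (All.tabulate (j (here refl)))
    with larger-half {2 ^ (r + suc s) * t} {length Y₁} {length Y₂} (≤-trans (≤-reflexive (sym (2^-suc-* (r + suc s) t))) (≤-trans ly (≤-reflexive (trans (↭.↭-length split) (length-++ Y₁)))))
  ... | inj₁ le = map⊎ (extend-pair split es) (weaken-pair split)
    (ramsey r (suc s) t (λ x∈ y∈ → j (there x∈) (↭.∈-resp-↭ (↭-sym split) (∈-++⁺ˡ y∈))) lx le)
  ... | inj₂ le = map⊎ (weaken-pair split′) (extend-pair split′ es′)
    (ramsey (suc r) s t (λ x∈ y∈ → j (there x∈) (↭.∈-resp-↭ (↭-sym split′) (∈-++⁺ˡ y∈)))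
      (≤-trans (≤-reflexive (sym (+-suc r s))) lx) (≤-trans (≤-reflexive (cong (λ z → 2 ^ z * t) (sym (+-suc r s)))) le))
    where split′ = ↭-trans split (↭.++-comm Y₁ Y₂)

  trim : ∀ {b m t X Y} → MonoPair b m t X Y → Σ (MonoPair b m t X Y) λ P → length (MonoPair.K₂ P) ≡ t
  trim {t = t} (mono-pair {K₂ = K₂} {Y′ = Y′} sx sy mono e le) with K , K′ , refl , len ← split-at t {K₂} le =
    mono-pair sx (↭-trans sy (↭-reflexive (++-assoc K K′ Y′))) (All.map (++⁻ˡ K) mono) e (≤-reflexive (sym len)) , len

  blob-exists : ∀ t {X Y} → Joined X Y → t + t ≤ length X → 2 ^ (t + t) * t ≤ length Y →
    ∃ λ b → Σ (MonoPair b t t X Y) λ P → length (MonoPair.K₂ P) ≡ t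
  blob-exists t j lx ly with ramsey t t t j lx ly
  ... | inj₁ P = true , trim P
  ... | inj₂ P = false , trim P

  length-second : ∀ {m r} (X₁ : List V) {X₂} → length (X₁ ++ X₂) ≡ m + r → length X₁ ≡ m → length X₂ ≡ r
  length-second X₁ eq refl = +-cancelˡ-≡ (length X₁) _ _ (trans (sym (length-++ X₁)) eq)

  -- Three parts paired into regions

  -- 63 = 3 · 21, where 21 = 3 · 7 bounds the number of pieces on each side in the three regions.
  module Tripartite (θ : ℕ) (large : 63 < θ) where

    private
      t = θ + (θ + θ)
      N = region-bound t

    -- Every region needs its first side adjacent to `K₂` in C and its second side adjacent to `K₁`
    -- in A. The part B is adjacent to both, so `B₁` serves as second side against `A₂`, and `B₂` as
    -- first side against `C₂`. The total is 3 for absorption plus 2 per region.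
    three-regions : ∀ {A₁ A₂ B₁ B₂ C₁ C₂} → Joined (A₁ ++ A₂) (B₁ ++ B₂) → Joined (A₁ ++ A₂) (C₁ ++ C₂) →
      Joined (B₁ ++ B₂) (C₁ ++ C₂) →
      length A₁ ≡ length C₁ → length A₂ ≡ length B₁ → length B₂ ≡ length C₂ → N ≤ length A₁ →
      CycleCover ((A₁ ++ A₂) ++ (B₁ ++ B₂) ++ (C₁ ++ C₂)) 9
    three-regions {A₁} {A₂} {B₁} {B₂} {C₁} {C₂} jAB jAC jBC e₁ e₂ e₃ big
      with b , mono-pair {K₁} {K₂} {X} {Y} sA sC mono #K₁ _ , #K₂ ← blob-exists t {A₁} {C₁} (λ a c → jAC (∈-++⁺ˡ a) (∈-++⁺ˡ c))
             (≤-trans (m≤m+n _ _) big) (≤-trans (m≤n+m _ (t + t)) (≤-trans big (≤-reflexive e₁))) =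
      cover-↭
        (↭-trans (↭.++⁺ (↭.++⁺ʳ A₂ sA) (↭.++⁺ˡ (B₁ ++ B₂) (↭.++⁺ʳ C₂ sC)))
          (solve 8 (λ K₁ X A₂ B₁ B₂ K₂ Y C₂ → ((K₁ ⊕ X) ⊕ A₂) ⊕ ((B₁ ⊕ B₂) ⊕ ((K₂ ⊕ Y) ⊕ C₂)) ⊜
              K₁ ⊕ (K₂ ⊕ ((X ⊕ Y) ⊕ ((A₂ ⊕ B₁) ⊕ (B₂ ⊕ C₂))))) ↭-refl K₁ X A₂ B₁ B₂ K₂ Y C₂))
        (assemble mono (trans #K₁ (sym #K₂)) (≤-reflexive (sym #K₂)) large
          (region (λ x y → jAC (X⊆ x) (Y⊆ y)) (λ x y → jAC (X⊆ x) (K₂⊆ y)) (λ y x → joined-sym jAC (Y⊆ y) (K₁⊆ x)) eqXY ⊞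
          (region (λ x y → jAB (∈-++⁺ʳ A₁ x) (∈-++⁺ˡ y)) (λ x y → jAC (∈-++⁺ʳ A₁ x) (K₂⊆ y)) (λ y x → joined-sym jAB (∈-++⁺ˡ y) (K₁⊆ x)) e₂ ⊞
           region (λ x y → jBC (∈-++⁺ʳ B₁ x) (∈-++⁺ʳ C₁ y)) (λ x y → jBC (∈-++⁺ʳ B₁ x) (K₂⊆ y)) (λ y x → joined-sym jAC (∈-++⁺ʳ C₁ y) (K₁⊆ x)) e₃)))
      where
      open Regions b θ
      K₁⊆ : ∀ {v} → v ∈ K₁ → v ∈ A₁ ++ A₂
      K₁⊆ v∈ = ∈-++⁺ˡ (↭.∈-resp-↭ (↭-sym sA) (∈-++⁺ˡ v∈))
      X⊆ : ∀ {v} → v ∈ X → v ∈ A₁ ++ A₂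
      X⊆ v∈ = ∈-++⁺ˡ (↭.∈-resp-↭ (↭-sym sA) (∈-++⁺ʳ K₁ v∈))
      K₂⊆ : ∀ {v} → v ∈ K₂ → v ∈ C₁ ++ C₂
      K₂⊆ v∈ = ∈-++⁺ˡ (↭.∈-resp-↭ (↭-sym sC) (∈-++⁺ˡ v∈))
      Y⊆ : ∀ {v} → v ∈ Y → v ∈ C₁ ++ C₂
      Y⊆ v∈ = ∈-++⁺ˡ (↭.∈-resp-↭ (↭-sym sC) (∈-++⁺ʳ K₂ v∈))
      eqXY : length X ≡ length Y
      eqXY = +-cancelˡ-≡ t _ _ (trans (cong (_+ length X) (sym #K₁)) (trans (sym (length-++ K₁)) (trans (sym (↭.↭-length sA))
        (trans e₁ (trans (↭.↭-length sC) (trans (length-++ K₂) (cong (_+ length Y) #K₂)))))))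

    -- x, y and z count the AB-, BC- and AC-pairs.
    large-AC : ∀ {A B C} x y z → Joined A B → Joined A C → Joined B C →
      length A ≡ z + x → length B ≡ x + y → length C ≡ z + y → N ≤ z → CycleCover (A ++ B ++ C) 9
    large-AC {A} {B} {C} x y z jAB jAC jBC eA eB eC big
      with A₁ , A₂ , refl , #A₁ ← split-at z {A} (≤-trans (m≤m+n z x) (≤-reflexive (sym eA)))
      with B₁ , B₂ , refl , #B₁ ← split-at x {B} (≤-trans (m≤m+n x y) (≤-reflexive (sym eB)))
      with C₁ , C₂ , refl , #C₁ ← split-at z {C} (≤-trans (m≤m+n z y) (≤-reflexive (sym eC))) =
      three-regions {A₁} {A₂} {B₁} {B₂} {C₁} {C₂} jAB jAC jBC (trans #A₁ (sym #C₁)) (trans (length-second A₁ eA #A₁) (sym #B₁))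
        (trans (length-second B₁ eB #B₁) (sym (length-second C₁ eC #C₁))) (≤-trans big (≤-reflexive (sym #A₁)))

    -- If `h` disjoint pairs cover everything, each across two parts, then `length C` of them meet
    -- C, which leaves `h ∸ length C` for AB; likewise for the others. These numbers add up to `h`,
    -- so one reaches `N`, and renaming parts makes it the AC one.
    balanced-tripartite : ∀ {A B C} h → Joined A B → Joined A C → Joined B C → length A + (length B + length C) ≡ h + h →
      length A ≤ h → length B ≤ h → length C ≤ h → N + (N + N) ≤ h → CycleCover (A ++ B ++ C) 9
    balanced-tripartite {A} {B} {C} h jAB jAC jBC total a≤ b≤ c≤ big = go (N ≤? z) (N ≤? x) (N ≤? y)
      where
      open +-*-Solver using (_:+_; _:=_) renaming (solve to ring)
      a = length A
      b = length B
      c′ = length C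
      x = h ∸ c′
      y = h ∸ a
      z = h ∸ b
      hx : x + c′ ≡ h
      hx = m∸n+n≡m c≤
      hy : y + a ≡ h
      hy = m∸n+n≡m a≤
      hz : z + b ≡ h
      hz = m∸n+n≡m b≤
      eA : a ≡ z + x
      eA = +-cancelʳ-≡ (b + c′) _ _ (trans total (trans (sym (cong₂ _+_ hz hx)) (ring 4 (λ z b x c → (z :+ b) :+ (x :+ c) := (z :+ x) :+ (b :+ c)) refl z b x c′)))
      eB : b ≡ x + y
      eB = +-cancelʳ-≡ (a + c′) _ _ (trans (ring 3 (λ a b c → b :+ (a :+ c) := a :+ (b :+ c)) refl a b c′) (trans total
        (trans (sym (cong₂ _+_ hx hy)) (ring 4 (λ x c y a → (x :+ c) :+ (y :+ a) := (x :+ y) :+ (a :+ c)) refl x c′ y a))))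
      eC : c′ ≡ z + y
      eC = +-cancelʳ-≡ (a + b) _ _ (trans (ring 3 (λ a b c → c :+ (a :+ b) := a :+ (b :+ c)) refl a b c′) (trans total
        (trans (sym (cong₂ _+_ hz hy)) (ring 4 (λ z b y a → (z :+ b) :+ (y :+ a) := (z :+ y) :+ (a :+ b)) refl z b y a))))
      sum : z + (x + y) ≡ h
      sum = trans (cong (z +_) (sym eB)) hz
      go : Dec (N ≤ z) → Dec (N ≤ x) → Dec (N ≤ y) → CycleCover (A ++ B ++ C) 9
      go (yes le) _ _ = large-AC x y z jAB jAC jBC eA eB eC le
      go (no _) (yes le) _ =
        cover-↭ (solve 3 (λ A B C → A ⊕ (B ⊕ C) ⊜ A ⊕ (C ⊕ B)) ↭-refl A B C)
          (large-AC z y x jAC jAB (joined-sym jBC) (trans eA (+-comm z x)) eC eB le)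
      go (no _) (no _) (yes le) =
        cover-↭ (solve 3 (λ A B C → A ⊕ (B ⊕ C) ⊜ B ⊕ (A ⊕ C)) ↭-refl A B C)
          (large-AC x z y (joined-sym jAB) jBC jAC (trans eB (+-comm x y)) (trans eA (+-comm z x)) (trans eC (+-comm z y)) le)
      go (no p) (no q) (no r) = contradiction (≤-trans big (≤-reflexive (sym sum))) (<⇒≱ (+-mono-< (≰⇒> p) (+-mono-< (≰⇒> q) (≰⇒> r))))

    tripartite : ∀ {A B C} → Joined A B → Joined A C → Joined B C →
      let m = length A + (length B + length C) in
      2 * length A ≤ m → 2 * length B ≤ m → 2 * length C ≤ m → order-bound θ ≤ m → CycleCover (A ++ B ++ C) 10
    tripartite {A} {B} {C} jAB jAC jBC a≤ b≤ c≤ big with parity (length A + (length B + length C))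
    ... | inj₁ (h , eq) = weaken (balanced-tripartite h jAB jAC jBC eq (half eq a≤) (half eq b≤) (half eq c≤)
            (half eq (<⇒≤ big)))
      where
      half : ∀ {m l} → m ≡ h + h → 2 * l ≤ m → l ≤ h
      half {l = l} refl le = half-≤ (≤-trans (≤-reflexive (cong (l +_) (sym (+-identityʳ l)))) le)
      weaken : ∀ {L} → CycleCover L 9 → CycleCover L 10
      weaken (cs , len , rest) = cs , m≤n⇒m≤1+n len , rest
    -- For an odd total a vertex of A is dropped. If A were empty, B and C of size at most `h` could
    -- not reach 2h + 1.
    tripartite {[]} {B} {C} jAB jAC jBC a≤ b≤ c≤ big | inj₂ (h , eq) =
      contradiction (≤-reflexive (sym eq)) (<⇒≱ (s≤s (+-mono-≤ {length B} {h} {length C} {h} (half-odd eq b≤) (half-odd eq c≤))))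
    tripartite {v ∷ A} {B} {C} jAB jAC jBC a≤ b≤ c≤ big | inj₂ (h , eq) =
      -- Only A shrinks: B and C fit already, as twice their size is even and at most 2h + 1. The
      -- colour `true` is arbitrary.
      cover-++ (cover-cycle true {v ∷ []} tt ↭-refl)
        (balanced-tripartite h (jAB ∘ there) (jAC ∘ there) jBC (suc-injective eq)
          (<⇒≤ (half-odd eq a≤)) (half-odd eq b≤) (half-odd eq c≤) (half-odd eq (<⇒≤ big)))

  -- Grouping the classes into three parts

  below? : ∀ m → Decidable (λ v → toℕ (p v) < m)
  below? m v = toℕ (p v) <? m

  above? : ∀ m → Decidable (λ v → m < toℕ (p v))
  above? m v = m <? toℕ (p v)

  below above : ℕ → List V
  below m = filter (below? m) (allFin n)
  above m = filter (above? m) (allFin n)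

  length-below : length (below k) ≡ n
  length-below = trans (cong length (filter-all (below? k) {allFin n} (All.tabulate (λ {v} _ → toℕ<n (p v))))) (length-allFin n)

  above-small : ∀ m → ¬ (2 * length (below (suc m)) ≤ n) → 2 * length (above m) ≤ n
  above-small m big = +-cancelˡ-≤ n _ _ (begin
    n + 2 * length (above m)                             ≤⟨ +-monoˡ-≤ _ (<⇒≤ (≰⇒> big)) ⟩
    2 * length (below (suc m)) + 2 * length (above m)    ≡⟨ sym (*-distribˡ-+ 2 (length (below (suc m))) _) ⟩
    2 * (length (below (suc m)) + length (above m))
      ≤⟨ *-monoʳ-≤ 2 (disjoint-filters (below? (suc m)) (above? m) (λ { (s≤s le) → ≤⇒≯ le }) (allFin n)) ⟩
    2 * length (allFin n)                                ≡⟨ cong (2 *_) (length-allFin n) ⟩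
    2 * n                                                ≡⟨ cong (n +_) (+-identityʳ n) ⟩
    n + n                                                ∎)
    where open ≤-Reasoning

  -- At class `i` the cumulative size passes n/2: the classes before it hold at most half, those up
  -- to it more than half, so those after it less than half. An outer group may be empty, and one is
  -- when `k` is 2.
  median-class : 0 < n → ∃ λ (i : Fin k) → 2 * length (below (toℕ i)) ≤ n × 2 * length (above (toℕ i)) ≤ n
  median-class 0<n
    with m , m<k , small , big ← last-below (λ m → 2 * length (below m) ≤? n)
           (≤-trans (≤-reflexive (cong (λ l → 2 * length l) (filter-none (below? 0) {allFin n} (All.tabulate (λ _ ()))))) z≤n)
           k (λ le → contradiction (≤-trans (≤-reflexive (cong (2 *_) (sym length-below))) le) (<⇒≱ (≤-trans (m<m+n n 0<n) (+-monoʳ-≤ n (m≤m+n n 0))))) = fromℕ< m<k ,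
      subst (λ m → 2 * length (below m) ≤ n × 2 * length (above m) ≤ n) (sym (toℕ-fromℕ< m<k)) (small , above-small m big)

  cover-around : ∀ θ → 63 < θ → order-bound θ ≤ n → Fair p → (i : Fin k) →
    2 * length (below (toℕ i)) ≤ n → 2 * length (above (toℕ i)) ≤ n → CycleCover (allFin n) 10
  cover-around θ large big fair i A-small C-small =
    cover-↭ parts (Tripartite.tripartite θ large {A} {B} {C}
      (λ a b e → <-irrefl (trans (cong toℕ e) (cong toℕ (in-class b))) (in-below a))
      (λ a c e → <-asym (in-below a) (subst (λ j → toℕ i < toℕ j) (sym e) (in-above c)))
      (λ b c e → <-irrefl (trans (cong toℕ (sym (in-class b))) (cong toℕ e)) (in-above c))
      (≤-trans A-small (≤-reflexive (sym total))) (≤-trans (fair i) (≤-reflexive (sym total)))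
      (≤-trans C-small (≤-reflexive (sym total))) (≤-trans big (≤-reflexive (sym total))))
    where
    class? : Decidable (λ v → p v ≡ i)
    class? v = p v ≟ᶠ i
    A B C : List V
    A = below (toℕ i)
    B = filter class? (allFin n)
    C = above (toℕ i)
    in-below : ∀ {v} → v ∈ A → toℕ (p v) < toℕ i
    in-below v∈ = proj₂ (∈-filter⁻ (below? (toℕ i)) {xs = allFin n} v∈)
    in-class : ∀ {v} → v ∈ B → p v ≡ i
    in-class v∈ = proj₂ (∈-filter⁻ class? {xs = allFin n} v∈)
    in-above : ∀ {v} → v ∈ C → toℕ i < toℕ (p v)
    in-above v∈ = proj₂ (∈-filter⁻ (above? (toℕ i)) {xs = allFin n} v∈)
    compare : ∀ v → toℕ (p v) < toℕ i ⊎ p v ≡ i ⊎ toℕ i < toℕ (p v)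
    compare v with <-cmp (toℕ (p v)) (toℕ i)
    ... | tri< lt _ _ = inj₁ lt
    ... | tri≈ _ eq _ = inj₂ (inj₁ (toℕ-injective eq))
    ... | tri> _ _ gt = inj₂ (inj₂ gt)
    parts : allFin n ↭ A ++ B ++ C
    parts = trisect (below? (toℕ i)) class? (above? (toℕ i))
      (λ lt e → <-irrefl (cong toℕ e) lt) <-asym (λ e gt → <-irrefl (sym (cong toℕ e)) gt) compare (allFin n)
    total : length A + (length B + length C) ≡ n
    total = trans (sym (trans (length-++ A) (cong (length A +_) (length-++ B)))) (trans (sym (↭.↭-length parts)) (length-allFin n))

  cycle-cover : ∀ θ → 63 < θ → order-bound θ ≤ n → Fair p → CycleCover (allFin n) 10
  cycle-cover θ large big fair =
    let i , A-small , C-small = median-class (≤-trans (s≤s z≤n) big)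
    in cover-around θ large big fair i A-small C-small

  partition : ∀ {m} → 10 ≤ m → CycleCover (allFin n) 10 → PartitionIntoMonoCycles p c m
  partition 10≤m (cs , len , cyc , s) = cs , ≤-trans len 10≤m , cyc , ↭-sym s

open Coloured

theorem1p7 : ∃ λ (n₀ : ℕ) → (n k : ℕ) → n₀ ≤ n → 2 ≤ k →
    (p : Fin n → Fin k) → ClassesNonEmpty p → Fair p →
    (c : Colouring n) → Symmetric c →
    PartitionIntoMonoCycles p c 14 × (k ≡ 2 → PartitionIntoMonoCycles p c 12)
-- 64 is the least `θ` above 63; ten cycles serve both bounds.
theorem1p7 = order-bound 64 , λ n k n₀≤n _ p _ fair c c-sym →
  let cover = cycle-cover p c c-sym 64 ≤-refl n₀≤n fair
  in partition p c c-sym (m≤m+n 10 4) cover , λ _ → partition p c c-sym (m≤m+n 10 2) cover
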